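{- Let $G$, $H$, $F$, $A$, $B$, $C$ be as in the context, and let $R$ be an arbitrary $H$-optimal spanning subgraph of $G$. Then (1) $d_R(v)\in H(v)$ for all $v\in C$; (2) $d_R(v)\ge MH(v)$ for all $v\in A$; (3) $d_R(v)\le mH(v)$ for all $v\in B$.
   Context: $G$ is a finite simple graph and $H:V(G)\to 2^{\mathbb{N}}$ assigns to each vertex $x$ a nonempty finite set $H(x)$ of nonnegative integers. Write $mH(x)=\min H(x)$, $MH(x)=\max H(x)$. $H$ satisfies property $(*)$: for every vertex $x$ and every integer $i$ with $mH(x)\le i\le MH(x)$, if $i\notin H(x)$ then $i+1\in H(x)$. For a spanning subgraph $F$ of $G$ and $x\in V(G)$, $def(F;x)=dist(d_F(x),H(x))=\min_{h\in H(x)}|d_F(x)-h|$; $def_H[F]=\sum_{x\in V(G)}def(F;x)$; $def_H(G)=\min\{def_H[F]: F \text{ spanning subgraph of } G\}$. An $H$-factor is a spanning subgraph $F$ with $d_F(x)\in H(x)$ for all $x$; $F$ is $H$-optimal if $def_H[F]=def_H(G)$. Standing assumptions: $G$ has no $H$-factor, and $F$ is a fixed spanning subgraph of $G$ chosen as follows: among all spanning subgraphs with $d_F(v)\le MH(v)$ for all $v$, $F$ minimizes $def_H[F]$, and subject to this $E(F)$ is (inclusion-)minimal. Let $B_0=\{x: d_F(x)\notin H(x)\}$. For a trail $P$ (walk with no repeated edge), $F\triangle P$ is the spanning subgraph with edge set $E(F)\triangle E(P)$. A trail $P=v_0v_1\dots v_k$ is a changeable trail if: (a) $v_0\in B_0$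 and $v_0v_1\notin E(F)$; (b) $def(F;x)=def(F\triangle P;x)=0$ for every vertex $x$ of $P$ other than $v_0,v_k$; (c) if $v_0=v_i\ne v_k$ for some $i$, then $def(F;v_0)>def(F\triangle P;v_0)$; (d) every initial subtrail $v_0\dots v_l$, $l\le k$, also satisfies (a)–(c). A changeable trail is odd if its last edge is not in $F$, even otherwise; length-zero trails are even changeable trails. "A changeable trail from $B_0$ to $v$" means a changeable trail ending at $v$. $D$ is the set of vertices $v$ satisfying at least one of: (i) there exist both an even and an odd changeable trail from $B_0$ to $v$; (ii) $mH(v)<d_F(v)\le MH(v)$ and there is an even changeable trail from $B_0$ to $v$; (iii) $mH(v)\le d_F(v)<MH(v)$ and there is an odd changeable trail from $B_0$ to $v$. $B=\{v: \text{some even changeable trail ends at } v\}\setminus D$, $A=\{v: \text{some odd changeable trail ends at } v\}\setminus D$, $C=V(G)\setminus(A\cup B\cup D)$. -}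

module Defs where

open import Data.Nat using (ℕ; zero; suc; _≤_; _<_; _⊓_; _⊔_; ∣_-_∣)
open import Data.Bool using (Bool; true; false; _∧_; _∨_; _xor_; if_then_else_)
open import Data.Fin using (Fin; _≟_)
open import Data.List using (List; []; _∷_; map; allFin; take)
open import Data.Nat.ListAction using (sum)
open import Data.Bool.ListAction using (any)
open import Data.List.NonEmpty using (List⁺; _∷_; toList; foldr₁; last)
open import Data.List.Membership.Propositional using (_∈_)
open import Data.List.Relation.Unary.AllPairs using (AllPairs)
open import Data.Product using (_×_; _,_; ∃; ∃-syntax; Σ-syntax)
open import Data.Sum using (_⊎_)
open import Data.Maybe using (Maybe; just; nothing)
open import Relation.Nullary using (¬_)
open import Relation.Nullary.Decidable using (⌊_⌋)
open import Relation.Binary.PropositionalEquality using (_≡_; _≢_)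

record Graph (n : ℕ) : Set where
  field
    adj     : Fin n → Fin n → Bool
    sym     : ∀ u v → adj u v ≡ adj v u
    irrefl  : ∀ v → adj v v ≡ false
open Graph public

record Subgraph {n : ℕ} (G : Graph n) : Set where
  field
    edge : Fin n → Fin n → Bool
    sym  : ∀ u v → edge u v ≡ edge v u
    sub  : ∀ u v → edge u v ≡ true → adj G u v ≡ true
open Subgraph public

deg : {n : ℕ} → (Fin n → Fin n → Bool) → Fin n → ℕ
deg {n} S x = sum (map (λ y → if S x y then 1 else 0) (allFin n))

-- The degree prescription H : V → nonempty finite sets of naturals

Prescription : ℕ → Set
Prescription n = Fin n → List⁺ ℕ

mH : {n : ℕ} → Prescription n → Fin n → ℕ
mH H x = foldr₁ _⊓_ (H x)

MH : {n : ℕ} → Prescription n → Fin n → ℕ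
MH H x = foldr₁ _⊔_ (H x)

_∈H_ : ℕ → List⁺ ℕ → Set
d ∈H h = d ∈ toList h

Star : {n : ℕ} → Prescription n → Set
Star H = ∀ x (i : ℕ) → mH H x ≤ i → i ≤ MH H x → ¬ (i ∈H H x) → suc i ∈H H x

dist : ℕ → List⁺ ℕ → ℕ
dist d h = foldr₁ _⊓_ (Data.List.NonEmpty.map (λ k → ∣ d - k ∣) h)

defAt : {n : ℕ} → Prescription n → (Fin n → Fin n → Bool) → Fin n → ℕ
defAt H S x = dist (deg S x) (H x)

defSum : {n : ℕ} → Prescription n → (Fin n → Fin n → Bool) → ℕ
defSum {n} H S = sum (map (defAt H S) (allFin n))

IsHFactor : {n : ℕ} {G : Graph n} → Prescription n → Subgraph G → Set
IsHFactor H F = ∀ x → deg (edge F) x ∈H H x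

HasHFactor : {n : ℕ} → Graph n → Prescription n → Set
HasHFactor G H = ∃[ F ] IsHFactor {G = G} H F

HOptimal : {n : ℕ} {G : Graph n} → Prescription n → Subgraph G → Set
HOptimal {G = G} H R = ∀ (F' : Subgraph G) → defSum H (edge R) ≤ defSum H (edge F')

Bounded : {n : ℕ} {G : Graph n} → Prescription n → Subgraph G → Set
Bounded H F = ∀ v → deg (edge F) v ≤ MH H v

ChosenF : {n : ℕ} {G : Graph n} → Prescription n → Subgraph G → Set
ChosenF {G = G} H F =
  Bounded H F
  × (∀ (F' : Subgraph G) → Bounded H F' → defSum H (edge F) ≤ defSum H (edge F'))
  × (∀ (F' : Subgraph G) → Bounded H F' → defSum H (edge F') ≡ defSum H (edge F)
       → (∀ u v → edge F' u v ≡ true → edge F u v ≡ true)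
       → ∀ u v → edge F' u v ≡ edge F u v)

InB0 : {n : ℕ} → Prescription n → (Fin n → Fin n → Bool) → Fin n → Set
InB0 H F x = ¬ (deg F x ∈H H x)

-- Trails.  A walk v0 v1 ... vk is represented as v0 ∷ vs : List⁺ (Fin n).

edgesFrom : {n : ℕ} → Fin n → List (Fin n) → List (Fin n × Fin n)
edgesFrom a []       = []
edgesFrom a (b ∷ bs) = (a , b) ∷ edgesFrom b bs

walkEdges : {n : ℕ} → List⁺ (Fin n) → List (Fin n × Fin n)
walkEdges (a ∷ bs) = edgesFrom a bs

SameEdge : {n : ℕ} → Fin n × Fin n → Fin n × Fin n → Set
SameEdge (a , b) (c , d) = (a ≡ c × b ≡ d) ⊎ (a ≡ d × b ≡ c)

data IsWalk {n : ℕ} (G : Graph n) : Fin n → List (Fin n) → Set where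
  stop : ∀ {a} → IsWalk G a []
  step : ∀ {a b bs} → adj G a b ≡ true → IsWalk G b bs → IsWalk G a (b ∷ bs)

IsTrail : {n : ℕ} → Graph n → List⁺ (Fin n) → Set
IsTrail G (a ∷ bs) =
  IsWalk G a bs × AllPairs (λ e e' → ¬ SameEdge e e') (edgesFrom a bs)

inWalk : {n : ℕ} → List⁺ (Fin n) → Fin n → Fin n → Bool
inWalk P u v = any (λ e → (⌊ Data.Product.proj₁ e ≟ u ⌋ ∧ ⌊ Data.Product.proj₂ e ≟ v ⌋)
                        ∨ (⌊ Data.Product.proj₁ e ≟ v ⌋ ∧ ⌊ Data.Product.proj₂ e ≟ u ⌋))
                   (walkEdges P)

_△_ : {n : ℕ} → (Fin n → Fin n → Bool) → List⁺ (Fin n) → (Fin n → Fin n → Bool)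
(F △ P) u v = F u v xor inWalk P u v

first : {n : ℕ} → List⁺ (Fin n) → Fin n
first (a ∷ _) = a

CondA : {n : ℕ} → Prescription n → (Fin n → Fin n → Bool) → List⁺ (Fin n) → Set
CondA H F (v0 ∷ [])      = InB0 H F v0
CondA H F (v0 ∷ v1 ∷ _)  = InB0 H F v0 × F v0 v1 ≡ false

CondB : {n : ℕ} → Prescription n → (Fin n → Fin n → Bool) → List⁺ (Fin n) → Set
CondB H F P = ∀ x → x ∈ toList P → x ≢ first P → x ≢ last P
                → defAt H F x ≡ 0 × defAt H (F △ P) x ≡ 0

CondC : {n : ℕ} → Prescription n → (Fin n → Fin n → Bool) → List⁺ (Fin n) → Set
CondC H F (v0 ∷ vs) = v0 ∈ vs → v0 ≢ last (v0 ∷ vs)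
                        → defAt H (F △ (v0 ∷ vs)) v0 < defAt H F v0

CondABC : {n : ℕ} → Prescription n → (Fin n → Fin n → Bool) → List⁺ (Fin n) → Set
CondABC H F P = CondA H F P × CondB H F P × CondC H F P

Changeable : {n : ℕ} → Graph n → Prescription n → (Fin n → Fin n → Bool)
             → List⁺ (Fin n) → Set
Changeable G H F (v0 ∷ vs) =
  IsTrail G (v0 ∷ vs) × (∀ (l : ℕ) → CondABC H F (v0 ∷ take l vs))

lastStep : {n : ℕ} → Fin n → List (Fin n) → Maybe (Fin n × Fin n)
lastStep a []       = nothing
lastStep a (b ∷ bs) with lastStep b bs
... | nothing = just (a , b)
... | just e  = just e

OddWalk : {n : ℕ} → (Fin n → Fin n → Bool) → List⁺ (Fin n) → Set
OddWalk F (a ∷ bs) = ∃[ u ] ∃[ w ] (lastStep a bs ≡ just (u , w) × F u w ≡ false)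

EvenWalk : {n : ℕ} → (Fin n → Fin n → Bool) → List⁺ (Fin n) → Set
EvenWalk F (a ∷ bs) =
  lastStep a bs ≡ nothing ⊎ (∃[ u ] ∃[ w ] (lastStep a bs ≡ just (u , w) × F u w ≡ true))

EvenTo : {n : ℕ} → Graph n → Prescription n → (Fin n → Fin n → Bool) → Fin n → Set
EvenTo G H F v = ∃[ P ] (Changeable G H F P × EvenWalk F P × last P ≡ v)

OddTo : {n : ℕ} → Graph n → Prescription n → (Fin n → Fin n → Bool) → Fin n → Set
OddTo G H F v = ∃[ P ] (Changeable G H F P × OddWalk F P × last P ≡ v)

InD : {n : ℕ} → Graph n → Prescription n → (Fin n → Fin n → Bool) → Fin n → Set
InD G H F v =
  (EvenTo G H F v × OddTo G H F v)
  ⊎ ((mH H v < deg F v × deg F v ≤ MH H v) × EvenTo G H F v)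
  ⊎ ((mH H v ≤ deg F v × deg F v < MH H v) × OddTo G H F v)

InB : {n : ℕ} → Graph n → Prescription n → (Fin n → Fin n → Bool) → Fin n → Set
InB G H F v = EvenTo G H F v × ¬ InD G H F v

InA : {n : ℕ} → Graph n → Prescription n → (Fin n → Fin n → Bool) → Fin n → Set
InA G H F v = OddTo G H F v × ¬ InD G H F v

InC : {n : ℕ} → Graph n → Prescription n → (Fin n → Fin n → Bool) → Fin n → Set
InC G H F v = ¬ InA G H F v × ¬ InB G H F v × ¬ InD G H F v

{-# OPTIONS --safe #-}

-- Suppose X and Y are optimal and the degree of X at x is not prescribed.  Toggling in X an edge
-- of X △ Y at x that repairs x must, by optimality, damage its other end, so the defect can be
-- pushed along edges of X △ Y until it reaches a vertex where Y is defective too.  Read backwards,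
-- the same edges push a defect of Y to x.  For Y = F the backward trail is changeable: hence every
-- vertex missed by an optimal R is the end of a changeable trail, whose parity is given by the
-- sign of d_F − d_R, and (1) follows.  For (2) and (3), if d_R(v) is prescribed but lies on the wrong side,
-- take Y = R and X = F △ P with P a changeable trail ending in v: the first time the backward
-- trail meets v, it yields an optimal subgraph that misses v and is still on the wrong side.  This
-- produces a changeable trail to v of the other parity, so v ∈ D.
module Submission where

open import Defs
import Data.Bool as Bool
open import Data.Bool using (Bool; true; false; not; _∧_; _∨_; _xor_; if_then_else_)
open import Data.Bool.Properties using (∧-comm; ∨-comm; ∨-assoc; ∨-identityʳ; xor-assoc; xor-comm; xor-identityʳ; not-involutive; ¬-not; not-¬)
open import Data.Empty using (⊥-elim)
open import Data.Fin using (Fin; zero; suc; _≟_)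
open import Data.Fin.Properties using (any?)
open import Data.List using (List; []; _∷_; _∷ʳ_; map; allFin; take; length; initLast; _∷ʳ′_)
open import Data.List.NonEmpty using (List⁺; _∷_; toList; foldr₁; last)
open import Data.List.Membership.Propositional using (_∈_)
open import Data.List.Membership.Propositional.Properties using (∈-map⁺; ∈-map⁻; ∈-++⁺ˡ; ∈-++⁻)
open import Data.List.Properties using (map-tabulate; take-[]; take-all)
open import Data.List.Relation.Unary.All as All using (All; []; _∷_)
open import Data.List.Relation.Unary.All.Properties using () renaming (∷ʳ⁻ to All-∷ʳ⁻)
open import Data.List.Relation.Unary.AllPairs using (AllPairs; []; _∷_)
import Data.List.Relation.Unary.AllPairs.Properties as AllPairs
open import Data.List.Relation.Unary.Any using (here; there)
open import Data.List.Reverse using (Reverse; []; _∶_∶ʳ_; reverseView)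
open import Data.Maybe using (just)
open import Data.Nat using (ℕ; zero; suc; _+_; _≤_; _<_; _⊓_; _⊔_; ∣_-_∣; z≤n; s≤s; s≤s⁻¹; _≤?_; _<?_)
open import Data.List.Membership.DecPropositional Data.Nat._≟_ using (_∈?_)
open import Data.Nat.Induction using (<-wellFounded)
open import Data.Nat.ListAction using (sum)
open import Data.Nat.Properties hiding (_≟_; _≤?_; _<?_)
open import Data.Product using (_×_; _,_; proj₁; proj₂; ∃-syntax)
open import Data.Sum using (_⊎_; inj₁; inj₂)
open import Function using (_∘_; _∋_; id)
open import Induction.WellFounded using (Acc; acc)
open import Relation.Binary.Definitions using (tri<; tri≈; tri>)
open import Relation.Binary.PropositionalEquality using (_≡_; _≢_; refl; trans; cong; cong₂; subst) renaming (sym to ≡-sym)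
open import Relation.Nullary using (¬_; Dec; yes; no; contradiction)
open import Relation.Nullary.Decidable using (⌊_⌋; _×-dec_; ¬?)

-- Sums over the vertices

total : {n : ℕ} → (Fin n → ℕ) → ℕ
total {n} f = sum (map f (allFin n))

total-suc : {n : ℕ} (f : Fin (suc n) → ℕ) → total f ≡ f zero + total (f ∘ suc)
total-suc f = cong (λ l → f zero + sum l)
  (trans (map-tabulate suc f) (≡-sym (map-tabulate id (f ∘ suc))))

total-mono-≤ : {n : ℕ} (f g : Fin n → ℕ) → (∀ z → f z ≤ g z) → total f ≤ total g
total-mono-≤ {zero}  f g f≤g = z≤n
total-mono-≤ {suc n} f g f≤g rewrite total-suc f | total-suc g =
  +-mono-≤ (f≤g zero) (total-mono-≤ (f ∘ suc) (g ∘ suc) (f≤g ∘ suc))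

total-mono-< : {n : ℕ} (f g : Fin n → ℕ) → (∀ z → f z ≤ g z) → ∀ x → f x < g x → total f < total g
total-mono-< {suc n} f g f≤g zero fx<gx rewrite total-suc f | total-suc g =
  +-mono-<-≤ fx<gx (total-mono-≤ (f ∘ suc) (g ∘ suc) (f≤g ∘ suc))
total-mono-< {suc n} f g f≤g (suc x) fx<gx rewrite total-suc f | total-suc g =
  +-mono-≤-< (f≤g zero) (total-mono-< (f ∘ suc) (g ∘ suc) (f≤g ∘ suc) x fx<gx)

total-cong : {n : ℕ} (f g : Fin n → ℕ) → (∀ z → f z ≡ g z) → total f ≡ total g
total-cong f g f≡g = ≤-antisym (total-mono-≤ f g (≤-reflexive ∘ f≡g))
                               (total-mono-≤ g f (≤-reflexive ∘ ≡-sym ∘ f≡g))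

total-bump : {n : ℕ} (f g : Fin n → ℕ) (x : Fin n) → g x ≡ suc (f x) → (∀ z → z ≢ x → g z ≡ f z)
           → total g ≡ suc (total f)
total-bump {suc n} f g zero gx eq rewrite total-suc f | total-suc g =
  cong₂ _+_ gx (total-cong (g ∘ suc) (f ∘ suc) (λ z → eq (suc z) λ ()))
total-bump {suc n} f g (suc x) gx eq rewrite total-suc f | total-suc g =
  trans (cong₂ _+_ (eq zero λ ()) (total-bump (f ∘ suc) (g ∘ suc) x gx
          (λ z z≢x → eq (suc z) λ { refl → z≢x refl })))
        (+-suc (f zero) (total (f ∘ suc)))

-- Raising `f` by one at `y` gives a function that dominates `g`, strictly at `x`; hence `total g`
-- is below `suc (total f)`.
total-transfer : {n : ℕ} (f g : Fin n → ℕ) (x y : Fin n) → x ≢ y → g x < f x → g y ≤ suc (f y)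
               → (∀ z → z ≢ x → z ≢ y → g z ≤ f z) → total g ≤ total f
total-transfer f g x y x≢y gx<fx gy≤ g≤f =
  s≤s⁻¹ (subst (total g <_) (total-bump f bumped y bumped-y bumped-≢)
    (total-mono-< g bumped g≤bumped x (<-≤-trans gx<fx (≤-reflexive (≡-sym (bumped-≢ x x≢y))))))
  where
  bumped : Fin _ → ℕ
  bumped z with z ≟ y
  ... | yes _ = suc (f z)
  ... | no  _ = f z
  bumped-y : bumped y ≡ suc (f y)
  bumped-y with y ≟ y
  ... | yes _ = refl
  ... | no y≢y = contradiction refl y≢y
  bumped-≢ : ∀ z → z ≢ y → bumped z ≡ f z
  bumped-≢ z z≢y with z ≟ y
  ... | yes z≡y = contradiction z≡y z≢y
  ... | no _ = refl
  g≤bumped : ∀ z → g z ≤ bumped z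
  g≤bumped z with z ≟ y | z ≟ x
  ... | yes refl | _        = gy≤
  ... | no  _    | yes refl = <⇒≤ gx<fx
  ... | no  z≢y  | no z≢x   = g≤f z z≢x z≢y

-- Distance to a nonempty finite set of naturals

minimum maximum : List⁺ ℕ → ℕ
minimum = foldr₁ _⊓_
maximum = foldr₁ _⊔_

-- The local recursion inside foldr₁ also depends on the whole list; fold is that
-- recursion, found by unification once the parameter y ∷ ys is abstracted.
mutual
  fold : (ℕ → ℕ → ℕ) → ℕ → List ℕ → ℕ → List ℕ → ℕ
  fold = _

  foldr₁-fold : ∀ f x y ys → foldr₁ f (x ∷ y ∷ ys) ≡ f x (fold f x (y ∷ ys) y ys)
  foldr₁-fold f x y ys with List ℕ ∋ y ∷ ys
  ... | _ = refl

fold-irrelevant : ∀ f x xs x′ xs′ y ys → fold f x xs y ys ≡ fold f x′ xs′ y ys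
fold-irrelevant f x xs x′ xs′ y []       = refl
fold-irrelevant f x xs x′ xs′ y (z ∷ zs) = cong (f y) (fold-irrelevant f x xs x′ xs′ z zs)

foldr₁-∷ : ∀ f x y ys → foldr₁ f (x ∷ y ∷ ys) ≡ f x (foldr₁ f (y ∷ ys))
foldr₁-∷ f x y ys = cong (f x) (fold-irrelevant f x (y ∷ ys) y ys y ys)

foldr₁-∈ : ∀ f → (∀ x y → f x y ≡ x ⊎ f x y ≡ y) → ∀ x xs → foldr₁ f (x ∷ xs) ∈ x ∷ xs
foldr₁-∈ f sel x []       = here refl
foldr₁-∈ f sel x (y ∷ ys) with sel x (foldr₁ f (y ∷ ys))
... | inj₁ eq = here (trans (foldr₁-∷ f x y ys) eq)
... | inj₂ eq = there (subst (_∈ y ∷ ys) (≡-sym (trans (foldr₁-∷ f x y ys) eq)) (foldr₁-∈ f sel y ys))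

minimum-∈ : ∀ h → minimum h ∈ toList h
minimum-∈ (x ∷ xs) = foldr₁-∈ _⊓_ ⊓-sel x xs

maximum-∈ : ∀ h → maximum h ∈ toList h
maximum-∈ (x ∷ xs) = foldr₁-∈ _⊔_ ⊔-sel x xs

minimum-≤ : ∀ h {k} → k ∈ toList h → minimum h ≤ k
minimum-≤ (x ∷ [])     (here refl) = ≤-refl
minimum-≤ (x ∷ y ∷ ys) (here refl) = m⊓n≤m x _
minimum-≤ (x ∷ y ∷ ys) (there k∈) rewrite foldr₁-∷ _⊓_ x y ys =
  ≤-trans (m⊓n≤n x _) (minimum-≤ (y ∷ ys) k∈)

≤-maximum : ∀ h {k} → k ∈ toList h → k ≤ maximum h
≤-maximum (x ∷ [])     (here refl) = ≤-refl
≤-maximum (x ∷ y ∷ ys) (here refl) = m≤m⊔n x _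
≤-maximum (x ∷ y ∷ ys) (there k∈) rewrite foldr₁-∷ _⊔_ x y ys =
  ≤-trans (≤-maximum (y ∷ ys) k∈) (m≤n⊔m x _)

dist-attained : ∀ d h → ∃[ k ] (k ∈H h × dist d h ≡ ∣ d - k ∣)
dist-attained d h@(x ∷ xs) = ∈-map⁻ (λ k → ∣ d - k ∣) (minimum-∈ (Data.List.NonEmpty.map (λ k → ∣ d - k ∣) h))

dist-≤ : ∀ d h {k} → k ∈H h → dist d h ≤ ∣ d - k ∣
dist-≤ d h@(x ∷ xs) k∈ = minimum-≤ (Data.List.NonEmpty.map (λ k → ∣ d - k ∣) h) (∈-map⁺ (λ k → ∣ d - k ∣) k∈)

∈⇒dist≡0 : ∀ d h → d ∈H h → dist d h ≡ 0
∈⇒dist≡0 d h d∈ = n≤0⇒n≡0 (subst (dist d h ≤_) (∣n-n∣≡0 d) (dist-≤ d h d∈))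

dist≡0⇒∈ : ∀ d h → dist d h ≡ 0 → d ∈H h
dist≡0⇒∈ d h eq with dist-attained d h
... | k , k∈ , dk rewrite ∣m-n∣≡0⇒m≡n {d} {k} (trans (≡-sym dk) eq) = k∈

dist-Lipschitz : ∀ p q h → ∣ q - p ∣ ≤ 1 → dist q h ≤ suc (dist p h)
dist-Lipschitz p q h q~p with dist-attained p h
... | k , k∈ , eq rewrite eq =
  ≤-trans (dist-≤ q h k∈) (≤-trans (∣-∣-triangle q p k) (+-monoˡ-≤ ∣ p - k ∣ q~p))

∣n-1+n∣≡1 : ∀ n → ∣ n - suc n ∣ ≡ 1
∣n-1+n∣≡1 zero    = refl
∣n-1+n∣≡1 (suc n) = ∣n-1+n∣≡1 n

∣1+m-n∣<∣m-n∣ : ∀ {m n} → m < n → ∣ suc m - n ∣ < ∣ m - n ∣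
∣1+m-n∣<∣m-n∣ {zero}  {suc n} _         = ≤-refl
∣1+m-n∣<∣m-n∣ {suc m} {suc n} (s≤s m<n) = ∣1+m-n∣<∣m-n∣ m<n

∣m-n∣<∣1+m-n∣ : ∀ {m n} → n ≤ m → ∣ m - n ∣ < ∣ suc m - n ∣
∣m-n∣<∣1+m-n∣ {zero}  {zero}  _         = ≤-refl
∣m-n∣<∣1+m-n∣ {suc m} {zero}  _         = ≤-refl
∣m-n∣<∣1+m-n∣ {suc m} {suc n} (s≤s n≤m) = ∣m-n∣<∣1+m-n∣ n≤m

dist>0 : ∀ d h → ¬ (d ∈H h) → 0 < dist d h
dist>0 d h d∉ = n≢0⇒n>0 (d∉ ∘ dist≡0⇒∈ d h)

StarAt : List⁺ ℕ → Set
StarAt h = ∀ i → minimum h ≤ i → i ≤ maximum h → ¬ (i ∈H h) → suc i ∈H h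

-- Within the range of `h` the star property puts `suc d` into `h`; below the minimum a step up
-- approaches every element.
dist-suc-< : ∀ {d} h → StarAt h → ¬ (d ∈H h) → d < maximum h → dist (suc d) h < dist d h
dist-suc-< {d} h star d∉ d<M with minimum h ≤? d
... | yes m≤d = subst (_< dist d h) (≡-sym (∈⇒dist≡0 (suc d) h (star d m≤d (<⇒≤ d<M) d∉))) (dist>0 d h d∉)
... | no  m≰d with dist-attained d h
...   | k , k∈ , eq rewrite eq =
        ≤-<-trans (dist-≤ (suc d) h k∈) (∣1+m-n∣<∣m-n∣ (<-≤-trans (≰⇒> m≰d) (minimum-≤ h k∈)))

-- Within the range `d` itself must lie in `h`, since otherwise the star property at `d` would
-- prescribe `suc d`. Above the maximum a step down approaches every element.
dist-pred-< : ∀ {d} h → StarAt h → ¬ (suc d ∈H h) → minimum h < suc d → dist d h < dist (suc d) h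
dist-pred-< {d} h star d+∉ m<d+ with d ≤? maximum h
... | yes d≤M with d ∈? toList h
...   | yes d∈ = subst (_< dist (suc d) h) (≡-sym (∈⇒dist≡0 d h d∈)) (dist>0 (suc d) h d+∉)
...   | no  d∉ = contradiction (star d (s≤s⁻¹ m<d+) d≤M d∉) d+∉
dist-pred-< {d} h star d+∉ m<d+ | no d≰M with dist-attained (suc d) h
... | k , k∈ , eq rewrite eq =
      ≤-<-trans (dist-≤ d h k∈) (∣m-n∣<∣1+m-n∣ (≤-trans (≤-maximum h k∈) (<⇒≤ (≰⇒> d≰M))))

-- Shift b p q: toggling an edge whose status is b turns degree p into q.
Shift : Bool → ℕ → ℕ → Set
Shift false p q = q ≡ suc p
Shift true  p q = p ≡ suc q

-- A missed degree p with Good h b p approaches h when an edge of status b is toggled.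
Good : List⁺ ℕ → Bool → ℕ → Set
Good h true  p = minimum h < p
Good h false p = p < maximum h

Shift⇒close : ∀ b {p q} → Shift b p q → ∣ q - p ∣ ≤ 1
Shift⇒close false {p} refl = ≤-reflexive (trans (∣-∣-comm (suc p) p) (∣n-1+n∣≡1 p))
Shift⇒close true  {q = q} refl = ≤-reflexive (∣n-1+n∣≡1 q)

Good⇒closer : ∀ {h} b {p q} → StarAt h → Shift b p q → ¬ (p ∈H h) → Good h b p → dist q h < dist p h
Good⇒closer {h} false star refl p∉ p<M = dist-suc-< h star p∉ p<M
Good⇒closer {h} true  star refl p∉ m<p = dist-pred-< h star p∉ m<p

farther⇒∉ : ∀ {h p q} → dist p h < dist q h → ¬ (q ∈H h)
farther⇒∉ {h} {p} {q} p<q q∈ = n≮0 (subst (dist p h <_) (∈⇒dist≡0 q h q∈) p<q)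

farther⇒Good : ∀ {h} b {p q} → StarAt h → Shift b p q → dist p h < dist q h → Good h (not b) q
farther⇒Good {h} false {p} star refl p<q with minimum h <? suc p
... | yes m<q = m<q
... | no  m≮q = contradiction p<q (<⇒≯ (dist-suc-< h star
        (λ p∈ → m≮q (s≤s (minimum-≤ h p∈)))
        (≤-trans (≮⇒≥ m≮q) (minimum-≤ h (maximum-∈ h)))))
farther⇒Good {h} true {q = q} star refl p<q with q <? maximum h
... | yes q<M = q<M
... | no  q≮M = contradiction p<q (<⇒≯ (dist-pred-< h star
        (λ p∈ → q≮M (≤-maximum h p∈))
        (s≤s (≤-trans (minimum-≤ h (maximum-∈ h)) (≮⇒≥ q≮M)))))

∉⇒Good : ∀ h {d} → ¬ (d ∈H h) → ∃[ b ] Good h b d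
∉⇒Good h {d} d∉ with minimum h <? d
... | yes m<d = true , m<d
... | no  m≮d = false , ≤-trans (≤∧≢⇒< (≮⇒≥ m≮d) λ { refl → d∉ (minimum-∈ h) })
                                (minimum-≤ h (maximum-∈ h))

-- Toggling an edge

Edges : ℕ → Set
Edges n = Fin n → Fin n → Bool

-- The same Boolean expression as the test in `inWalk`, so that `inWalk` unfolds by computation to a
-- disjunction of `isEdge`s.
isEdge : {n : ℕ} → Fin n → Fin n → Edges n
isEdge x y u w = (⌊ x ≟ u ⌋ ∧ ⌊ y ≟ w ⌋) ∨ (⌊ x ≟ w ⌋ ∧ ⌊ y ≟ u ⌋)

module _ {n : ℕ} where

  isEdge-sound : ∀ (x y u w : Fin n) → isEdge x y u w ≡ true → SameEdge (x , y) (u , w)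
  isEdge-sound x y u w eq with x ≟ u | y ≟ w | x ≟ w | y ≟ u
  ... | yes p | yes q | _     | _     = inj₁ (p , q)
  ... | yes _ | no  _ | yes p | yes q = inj₂ (p , q)
  ... | no  _ | _     | yes p | yes q = inj₂ (p , q)

  isEdge-complete : ∀ (x y u w : Fin n) → SameEdge (x , y) (u , w) → isEdge x y u w ≡ true
  isEdge-complete x y u w same with x ≟ u | y ≟ w | x ≟ w | y ≟ u
  ... | yes _ | yes _ | _     | _     = refl
  ... | yes _ | no  _ | yes _ | yes _ = refl
  ... | no  _ | _     | yes _ | yes _ = refl
  isEdge-complete x y u w (inj₁ (p , q)) | no ¬p | _     | _     | _     = contradiction p ¬p
  isEdge-complete x y u w (inj₁ (p , q)) | yes _ | no ¬q | _     | _     = contradiction q ¬q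
  isEdge-complete x y u w (inj₂ (p , q)) | yes _ | no _  | no ¬p | _     = contradiction p ¬p
  isEdge-complete x y u w (inj₂ (p , q)) | yes _ | no _  | yes _ | no ¬q = contradiction q ¬q
  isEdge-complete x y u w (inj₂ (p , q)) | no _  | _     | no ¬p | _     = contradiction p ¬p
  isEdge-complete x y u w (inj₂ (p , q)) | no _  | _     | yes _ | no ¬q = contradiction q ¬q

  isEdge-false : ∀ (x y u w : Fin n) → ¬ SameEdge (x , y) (u , w) → isEdge x y u w ≡ false
  isEdge-false x y u w ¬same = ¬-not (¬same ∘ isEdge-sound x y u w)

  isEdge-swap : ∀ (x y u w : Fin n) → isEdge x y u w ≡ isEdge y x u w
  isEdge-swap x y u w = trans (∨-comm (⌊ x ≟ u ⌋ ∧ ⌊ y ≟ w ⌋) _)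
    (cong₂ _∨_ (∧-comm ⌊ x ≟ w ⌋ _) (∧-comm ⌊ x ≟ u ⌋ _))

  isEdge-flip : ∀ (x y u w : Fin n) → isEdge x y u w ≡ isEdge x y w u
  isEdge-flip x y u w = ∨-comm (⌊ x ≟ u ⌋ ∧ ⌊ y ≟ w ⌋) _

  toggle : Edges n → Fin n → Fin n → Edges n
  toggle S x y u w = S u w xor isEdge x y u w

  toggle-off : ∀ S (x y u w : Fin n) → ¬ SameEdge (x , y) (u , w) → toggle S x y u w ≡ S u w
  toggle-off S x y u w ¬same rewrite isEdge-false x y u w ¬same = xor-identityʳ (S u w)

  toggle-on : ∀ S (x y u w : Fin n) → SameEdge (x , y) (u , w) → toggle S x y u w ≡ not (S u w)
  toggle-on S x y u w same rewrite isEdge-complete x y u w same = xor-comm (S u w) true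

  deg-cong : ∀ {S T : Edges n} {x} → (∀ y → S x y ≡ T x y) → deg S x ≡ deg T x
  deg-cong eq = total-cong _ _ λ y → cong (if_then 1 else 0) (eq y)

  deg-mono : ∀ {S T : Edges n} {x} → (∀ y → S x y ≡ true → T x y ≡ true) → deg S x ≤ deg T x
  deg-mono {S} {T} {x} S⊆T = total-mono-≤ _ _ le
    where
    le : ∀ y → (if S x y then 1 else 0) ≤ (if T x y then 1 else 0)
    le y with S x y in eq
    ... | false = z≤n
    ... | true rewrite S⊆T y eq = ≤-refl

  deg-toggle-tail : ∀ (S : Edges n) {x y b} → x ≢ y → S x y ≡ b → Shift b (deg S x) (deg (toggle S x y) x)
  deg-toggle-tail S {x} {y} {b} x≢y Sxy = go b Sxy
    where
    at-y : toggle S x y x y ≡ not (S x y)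
    at-y = toggle-on S x y x y (inj₁ (refl , refl))
    off-y : ∀ z → z ≢ y → toggle S x y x z ≡ S x z
    off-y z z≢y = toggle-off S x y x z λ { (inj₁ (_ , y≡z)) → z≢y (≡-sym y≡z) ; (inj₂ (_ , y≡x)) → x≢y (≡-sym y≡x) }
    value : Bool → ℕ
    value c = if c then 1 else 0
    go : ∀ b → S x y ≡ b → Shift b (deg S x) (deg (toggle S x y) x)
    go false eq = total-bump _ _ y
      (trans (cong value (trans at-y (cong not eq))) (cong (suc ∘ value) (≡-sym eq)))
      (λ z z≢y → cong value (off-y z z≢y))
    go true eq = total-bump _ _ y
      (trans (cong value eq) (cong (suc ∘ value) (≡-sym (trans at-y (cong not eq)))))
      (λ z z≢y → cong value (≡-sym (off-y z z≢y)))

  deg-toggle-head : ∀ (S : Edges n) {x y b} → x ≢ y → S y x ≡ b → Shift b (deg S y) (deg (toggle S x y) y)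
  deg-toggle-head S {x} {y} {b} x≢y Syx = subst (Shift b (deg S y))
    (deg-cong {toggle S y x} {toggle S x y} λ w → cong (S y w xor_) (isEdge-swap y x y w))
    (deg-toggle-tail S (x≢y ∘ ≡-sym) Syx)

  deg-toggle-other : ∀ (S : Edges n) {x y z} → z ≢ x → z ≢ y → deg (toggle S x y) z ≡ deg S z
  deg-toggle-other S {x} {y} {z} z≢x z≢y = deg-cong {toggle S x y} {S} λ w →
    toggle-off S x y z w λ { (inj₁ (x≡z , _)) → z≢x (≡-sym x≡z) ; (inj₂ (_ , y≡z)) → z≢y (≡-sym y≡z) }

-- Optimal subgraphs

not-b≢b : ∀ b → not b ≢ b
not-b≢b true  ()
not-b≢b false ()

module Optimal {n : ℕ} (G : Graph n) (H : Prescription n) (star : Star H) where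

  adj⇒≢ : ∀ {x y} → adj G x y ≡ true → x ≢ y
  adj⇒≢ {x} a refl with trans (≡-sym a) (irrefl G x)
  ... | ()

  adj-sym : ∀ {x y} → adj G x y ≡ true → adj G y x ≡ true
  adj-sym {x} {y} a = trans (Graph.sym G y x) a

  toggled : (X : Subgraph G) (x y : Fin n) → adj G x y ≡ true → Subgraph G
  toggled X x y a = record
    { edge = toggle (edge X) x y
    ; sym  = λ u w → cong₂ _xor_ (Subgraph.sym X u w) (isEdge-flip x y u w)
    ; sub  = sub′
    }
    where
    sub′ : ∀ u w → toggle (edge X) x y u w ≡ true → adj G u w ≡ true
    sub′ u w eq with isEdge x y u w in same
    ... | false = sub X u w (trans (≡-sym (xor-identityʳ (edge X u w))) eq)
    ... | true with isEdge-sound x y u w same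
    ...   | inj₁ (refl , refl) = a
    ...   | inj₂ (refl , refl) = adj-sym a

  differ⇒adj : (X Y : Subgraph G) {x y : Fin n} (b : Bool) → edge X x y ≡ b → edge Y x y ≡ not b → adj G x y ≡ true
  differ⇒adj X Y true  Xxy _   = sub X _ _ Xxy
  differ⇒adj X Y false _   Yxy = sub Y _ _ Yxy

  exit? : (X Y : Subgraph G) (x : Fin n) (b : Bool)
        → (∃[ y ] (edge X x y ≡ b × edge Y x y ≡ not b)) ⊎ (∀ y → edge X x y ≡ b → edge Y x y ≡ b)
  exit? X Y x b with any? (λ y → (edge X x y Bool.≟ b) ×-dec (edge Y x y Bool.≟ not b))
  ... | yes found = inj₁ found
  ... | no  none  = inj₂ λ y Xxy → trans (¬-not (λ Yxy → none (y , Xxy , Yxy))) (not-involutive b)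

  -- Twice the number of edges of X △ Y, the measure on which `walk` recurses.
  distance : (X Y : Subgraph G) → ℕ
  distance X Y = total (deg (λ u w → edge X u w xor edge Y u w))

  distance-toggled : (X Y : Subgraph G) {x y : Fin n} (a : adj G x y ≡ true) (b : Bool)
                   → edge X x y ≡ b → edge Y x y ≡ not b
                   → distance (toggled X x y a) Y < distance X Y
  distance-toggled X Y {x} {y} a b Xxy Yxy = total-mono-< _ _ le x (lt x tail)
    where
    Δ Δ′ : Edges n
    Δ  u w = edge X u w xor edge Y u w
    Δ′ u w = edge (toggled X x y a) u w xor edge Y u w
    Δ′≗ : ∀ u w → toggle Δ x y u w ≡ Δ′ u w
    Δ′≗ u w = trans (xor-assoc (edge X u w) _ _)
      (trans (cong (edge X u w xor_) (xor-comm (edge Y u w) _)) (≡-sym (xor-assoc (edge X u w) _ _)))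
    differ : ∀ b → b xor not b ≡ true
    differ true  = refl
    differ false = refl
    Δxy : Δ x y ≡ true
    Δxy = trans (cong₂ _xor_ Xxy Yxy) (differ b)
    Δyx : Δ y x ≡ true
    Δyx = trans (cong₂ _xor_ (Subgraph.sym X y x) (Subgraph.sym Y y x)) Δxy
    tail : deg Δ x ≡ suc (deg (toggle Δ x y) x)
    tail = deg-toggle-tail Δ (adj⇒≢ a) Δxy
    head : deg Δ y ≡ suc (deg (toggle Δ x y) y)
    head = deg-toggle-head Δ (adj⇒≢ a) Δyx
    lt : ∀ z → deg Δ z ≡ suc (deg (toggle Δ x y) z) → deg Δ′ z < deg Δ z
    lt z eq = ≤-reflexive (trans (cong suc (≡-sym (deg-cong {S = toggle Δ x y} {Δ′} (Δ′≗ z)))) (≡-sym eq))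
    le : ∀ z → deg Δ′ z ≤ deg Δ z
    le z with z ≟ x | z ≟ y
    ... | yes refl | _        = <⇒≤ (lt x tail)
    ... | no _     | yes refl = <⇒≤ (lt y head)
    ... | no z≢x   | no z≢y   = ≤-reflexive
      (trans (≡-sym (deg-cong {S = toggle Δ x y} {Δ′} (Δ′≗ z))) (deg-toggle-other Δ z≢x z≢y))

  degree : Subgraph G → Fin n → ℕ
  degree X = deg (edge X)

  Missed : Subgraph G → Fin n → Set
  Missed X x = ¬ (degree X x ∈H H x)

  -- The gain at `x` is at least one; the degree at `y` moves by one, so the loss there is at most
  -- one.
  defSum-toggled-≤ : (X : Subgraph G) {x y : Fin n} (a : adj G x y ≡ true) {b : Bool}
                   → edge X x y ≡ b → Missed X x → Good (H x) b (degree X x)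
                   → defSum H (edge (toggled X x y a)) ≤ defSum H (edge X)
  defSum-toggled-≤ X {x} {y} a {b} Xxy missed good = total-transfer _ _ x y (adj⇒≢ a)
    (Good⇒closer b (star x) (deg-toggle-tail (edge X) (adj⇒≢ a) Xxy) missed good)
    (dist-Lipschitz (degree X y) (degree (toggled X x y a) y) (H y) (Shift⇒close b
      (deg-toggle-head (edge X) (adj⇒≢ a) (trans (Subgraph.sym X y x) Xxy))))
    (λ z z≢x z≢y → ≤-reflexive (cong (λ d → dist d (H z)) (deg-toggle-other (edge X) z≢x z≢y)))

  record Defective (X : Subgraph G) (x : Fin n) (b : Bool) : Set where
    field
      optimal : HOptimal H X
      missed  : Missed X x
      good    : Good (H x) b (degree X x)
  open Defective

  -- The toggle cannot lower the minimal sum, so the strict gain at `x` must be lost again, and only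
  -- `y` can lose it. Having moved away from `H y`, the degree at `y` is missed, and edges of the
  -- opposite status repair it.
  push : (X : Subgraph G) {x y : Fin n} (a : adj G x y ≡ true) {b : Bool}
       → edge X x y ≡ b → Defective X x b → Defective (toggled X x y a) y (not b)
  push X {x} {y} a {b} Xxy def = record
    { optimal = λ Z → ≤-trans (defSum-toggled-≤ X a Xxy (missed def) (good def)) (optimal def Z)
    ; missed  = farther⇒∉ {H y} {degree X y} farther
    ; good    = farther⇒Good b (star y) shift farther
    }
    where
    shift : Shift b (degree X y) (degree (toggled X x y a) y)
    shift = deg-toggle-head (edge X) (adj⇒≢ a) (trans (Subgraph.sym X y x) Xxy)
    closer : defAt H (toggle (edge X) x y) x < defAt H (edge X) x
    closer = Good⇒closer b (star x) (deg-toggle-tail (edge X) (adj⇒≢ a) Xxy) (missed def) (good def)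
    farther : defAt H (edge X) y < defAt H (toggle (edge X) x y) y
    farther = ≰⇒> λ y≤ → <⇒≱ (total-mono-< _ _ (le y≤) x closer) (optimal def (toggled X x y a))
      where
      le : defAt H (toggle (edge X) x y) y ≤ defAt H (edge X) y
         → ∀ z → defAt H (toggle (edge X) x y) z ≤ defAt H (edge X) z
      le y≤ z with z ≟ x | z ≟ y
      ... | yes refl | _        = <⇒≤ closer
      ... | no _     | yes refl = y≤
      ... | no z≢x   | no z≢y   =
        ≤-reflexive (cong (λ d → dist d (H z)) (deg-toggle-other (edge X) z≢x z≢y))

  -- Traces: moving a defect of `Y` along a trail

  module _ (Y : Subgraph G) where

    CanStop : Bool → Fin n → Set
    CanStop b x = Missed Y x × Good (H x) b (degree Y x)

    -- Trace b x W: W arises from Y by toggling a trail that ends in x, every prefix of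
    -- which moves the defect of Y to its current end; an edge of status b at x would
    -- continue the trail.
    data Trace : Bool → Fin n → Subgraph G → Set where
      stop : ∀ {b x} → CanStop b x → Trace b x Y
      step : ∀ {b c x y W} → Trace b y W → (a : adj G y x ≡ true)
           → edge W y x ≡ b → edge Y y x ≡ b
           → Good (H x) c (degree (toggled W y x a) x) → ¬ CanStop c x
           → Trace c x (toggled W y x a)

    canStop? : ∀ b x → Dec (CanStop b x)
    canStop? b x = ¬? (degree Y x ∈? toList (H x)) ×-dec good? b
      where
      good? : ∀ b → Dec (Good (H x) b (degree Y x))
      good? true  = mH H x <? degree Y x
      good? false = degree Y x <? MH H x

    module _ (Y-optimal : HOptimal H Y) where

      -- Optimality and the miss pass along every edge by `push`. The direction is read from the
      -- trace, as it need not be the one that `push` supplies.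
      trace⇒defective : ∀ {b x W} → Trace b x W → Defective W x b
      trace⇒defective (stop (missedY , goodY)) = record { optimal = Y-optimal ; missed = missedY ; good = goodY }
      trace⇒defective (step {W = W} t a Wyx _ good′ _) =
        record { optimal = optimal d ; missed = missed d ; good = good′ }
        where d = push W a Wyx (trace⇒defective t)

      Between : Subgraph G → Subgraph G → Set
      Between X W = ∀ u w → edge X u w ≡ edge Y u w → edge W u w ≡ edge Y u w

      between-toggled : ∀ X W {x y} (a : adj G x y ≡ true) (a′ : adj G y x ≡ true) b → edge X x y ≡ b → edge Y x y ≡ not b
                      → Between (toggled X x y a) W → Between X (toggled W y x a′)
      between-toggled X W {x} {y} a a′ b Xxy Yxy btw u w eq with isEdge x y u w in same
      ... | false = trans (cong (edge W u w xor_) (trans (isEdge-swap y x u w) same))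
                      (trans (xor-identityʳ _) (btw u w (trans (trans (cong (edge X u w xor_) same) (xor-identityʳ _)) eq)))
      ... | true with isEdge-sound x y u w same
      ...   | inj₁ (refl , refl) = contradiction (trans (≡-sym Yxy) (trans (≡-sym eq) Xxy)) (not-b≢b b)
      ...   | inj₂ (refl , refl) = contradiction
              (trans (≡-sym Yxy) (trans (Subgraph.sym Y x y) (trans (≡-sym eq) (trans (Subgraph.sym X y x) Xxy)))) (not-b≢b b)

      -- After the toggle `X` agrees with `Y` on the edge `x y`, hence so does `W`: the edge is
      -- still free to extend the trace.
      between-at : ∀ X W {x y} (a : adj G x y ≡ true) b → edge X x y ≡ b → edge Y x y ≡ not b
                 → Between (toggled X x y a) W → edge W y x ≡ not b × edge Y y x ≡ not b
      between-at X W {x} {y} a b Xxy Yxy btw =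
        trans (Subgraph.sym W y x) (trans (btw x y (trans (toggle-on (edge X) x y x y (inj₁ (refl , refl)))
                                                         (trans (cong not Xxy) (≡-sym Yxy)))) Yxy)
        , trans (Subgraph.sym Y y x) Yxy

      Traced : Subgraph G → Bool → Fin n → Set
      Traced X b x = ∃[ W ] (Trace b x W × Between X W)

      -- Pairs of status `b` at `x` in `X` keep this status in `Y`, and by `Between` also in `W`. So
      -- the degree in `W` meets the bound in `Good` with no less room.
      Good-between : ∀ {X W x} b → (∀ y → edge X x y ≡ b → edge Y x y ≡ b) → Between X W
                   → Good (H x) b (degree X x) → Good (H x) b (degree W x)
      Good-between {X} {W} {x} true keep btw good′ = <-≤-trans good′
        (deg-mono {S = edge X} {edge W} λ y Xxy → trans (btw x y (trans Xxy (≡-sym (keep y Xxy)))) (keep y Xxy))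
      Good-between {X} {W} {x} false keep btw good′ = ≤-<-trans
        (deg-mono {S = edge W} {edge X} λ y Wxy → ¬-not λ Xxy →
          not-¬ (trans (btw x y (trans Xxy (≡-sym (keep y Xxy)))) (keep y Xxy)) Wxy)
        good′

      -- Otherwise `degree X x` lies beyond the extreme of `H x` from which toggling status `b`
      -- leads back; by `keep` so does `degree Y x`, and `CanStop b x` would hold.
      Good-not : ∀ {X x} b → (∀ y → edge X x y ≡ b → edge Y x y ≡ b) → Defective X x b → ¬ CanStop b x
               → Good (H x) (not b) (degree X x)
      Good-not {X} {x} true keep def ¬stop = ≰⇒> λ M≤X →
        let M<Y = <-≤-trans (≤∧≢⇒< M≤X λ eq → missed def (subst (_∈H H x) eq (maximum-∈ (H x))))
                            (deg-mono {S = edge X} {edge Y} keep)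
        in ¬stop ((λ Y∈ → <⇒≱ M<Y (≤-maximum (H x) Y∈))
                 , ≤-<-trans (minimum-≤ (H x) (maximum-∈ (H x))) M<Y)
      Good-not {X} {x} false keep def ¬stop = ≰⇒> λ X≤m →
        let Y<m = ≤-<-trans (deg-mono {S = edge Y} {edge X} λ y Yxy → ¬-not λ Xxy → not-¬ (keep y Xxy) Yxy)
                            (≤∧≢⇒< X≤m λ eq → missed def (subst (_∈H H x) (≡-sym eq) (minimum-∈ (H x))))
        in ¬stop ((λ Y∈ → <⇒≱ Y<m (minimum-≤ (H x) Y∈))
                 , <-≤-trans Y<m (minimum-≤ (H x) (maximum-∈ (H x))))

      -- Follow edges of X △ Y, repairing the defect of X at x and creating one at the next
      -- vertex; toggling the same edges in Y, in reverse order, is a trace.  An exit that restores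
      -- the degree at x is preferred: if there is none, then at x the degrees of X and W
      -- compare with that of Y in the same sense, which is what Good needs.
      walk : ∀ X x b → Acc _<_ (distance X Y) → Defective X x b → Traced X b x
      walk X x b (acc rec) def with canStop? b x
      ... | yes canStop = Y , stop canStop , λ _ _ _ → refl
      ... | no ¬stop with exit? X Y x b
      ...   | inj₁ (y , Xxy , Yxy) = toggled W y x a′ , step t a′ Wyx Yyx goodW ¬stop , between-toggled X W a a′ b Xxy Yxy btw
        where
        a = differ⇒adj X Y b Xxy Yxy
        a′ = adj-sym a
        rest = walk (toggled X x y a) y (not b) (rec (distance-toggled X Y a b Xxy Yxy)) (push X a Xxy def)
        W = proj₁ rest
        t = proj₁ (proj₂ rest)
        btw = proj₂ (proj₂ rest)
        Wyx = proj₁ (between-at X W a b Xxy Yxy btw)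
        Yyx = proj₂ (between-at X W a b Xxy Yxy btw)
        goodW : Good (H x) b (degree (toggled W y x a′) x)
        goodW = subst (λ c → Good (H x) c (degree (toggled W y x a′) x)) (not-involutive b)
                  (good (push W a′ Wyx (trace⇒defective t)))
      ...   | inj₂ keep with exit? X Y x (not b)
      -- Without an exit of either status `X` and `Y` coincide at `x`, so `Y` has the defect itself.
      ...     | inj₂ keep′ = contradiction
                  ((subst (λ d → ¬ (d ∈H H x)) X≡Y (missed def)) , subst (Good (H x) b) X≡Y (good def)) ¬stop
        where
        same : ∀ y → edge X x y ≡ edge Y x y
        same y with edge X x y Bool.≟ b
        ... | yes Xxy = trans Xxy (≡-sym (keep y Xxy))
        ... | no  Xxy = trans (¬-not Xxy) (≡-sym (keep′ y (¬-not Xxy)))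
        X≡Y : degree X x ≡ degree Y x
        X≡Y = deg-cong {S = edge X} {edge Y} same
      ...     | inj₁ (y , Xxy , Yxy) = toggled W y x a′ , step t a′ Wyx Yyx goodW ¬stop , btw′
        where
        a = differ⇒adj X Y (not b) Xxy Yxy
        a′ = adj-sym a
        rest = walk (toggled X x y a) y (not (not b)) (rec (distance-toggled X Y a (not b) Xxy Yxy))
                 (push X a Xxy (record { optimal = optimal def ; missed = missed def ; good = Good-not {X} b keep def ¬stop }))
        W = proj₁ rest
        t = proj₁ (proj₂ rest)
        btw = proj₂ (proj₂ rest)
        Wyx = proj₁ (between-at X W a (not b) Xxy Yxy btw)
        Yyx = proj₂ (between-at X W a (not b) Xxy Yxy btw)
        btw′ = between-toggled X W a a′ (not b) Xxy Yxy btw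
        -- Pushing back along this edge would give direction `not b`; the required `b` comes from
        -- comparing degrees.
        goodW : Good (H x) b (degree (toggled W y x a′) x)
        goodW = Good-between {X} {toggled W y x a′} b keep btw′ (good def)

      trace : ∀ X {x b} → Defective X x b → Traced X b x
      trace X {x} {b} = walk X x b (<-wellFounded _)

      -- Being one step from the degree in `Y`, the degree in `U` cannot jump over an extreme of
      -- `H v`.
      NearMiss : Fin n → Set
      NearMiss v = ∃[ U ] ∃[ b ] (HOptimal H U × Missed U v × Shift b (degree Y v) (degree U v))

      -- The first visit of a trace to v shifts the degree that Y has there.
      trace⇒nearMiss : ∀ {v b x W} → degree Y v ∈H H v → Trace b x W
                     → NearMiss v ⊎ (x ≢ v × degree W v ≡ degree Y v)
      trace⇒nearMiss Yv∈ (stop (missedY , _)) = inj₂ ((λ { refl → missedY Yv∈ }) , refl)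
      trace⇒nearMiss {v} Yv∈ (step {b} {x = x} {W = W} t a Wyx _ _ _) with trace⇒nearMiss Yv∈ t
      ... | inj₁ near = inj₁ near
      ... | inj₂ (y≢v , eq) = cases (x ≟ v)
        where
        d = push W a Wyx (trace⇒defective t)
        cases : Dec (x ≡ v) → NearMiss v ⊎ (x ≢ v × degree (toggled W _ x a) v ≡ degree Y v)
        cases (yes refl) = inj₁ (toggled W _ x a , b , optimal d , missed d ,
          subst (λ p → Shift b p _) eq (deg-toggle-head (edge W) (adj⇒≢ a) (trans (Subgraph.sym W _ _) Wyx)))
        cases (no x≢v) = inj₂ (x≢v , trans (deg-toggle-other (edge W) (y≢v ∘ ≡-sym) (x≢v ∘ ≡-sym)) eq)

      nearMiss : ∀ X {v} → HOptimal H X → Missed X v → degree Y v ∈H H v → NearMiss v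
      nearMiss X {v} optX missX Yv∈
        with ∉⇒Good (H v) missX
      ... | b , goodX with trace X (record { optimal = optX ; missed = missX ; good = goodX })
      ...   | W , t , _ with trace⇒nearMiss Yv∈ t
      ...     | inj₁ near = near
      ...     | inj₂ (v≢v , _) = contradiction refl v≢v

-- Changeable trails, extended and shortened at their end

end : {A : Set} → A → List A → A
end a []       = a
end a (b ∷ bs) = end b bs

end-∷ʳ : {A : Set} (a : A) (us : List A) (v : A) → end a (us ∷ʳ v) ≡ v
end-∷ʳ a []       v = refl
end-∷ʳ a (u ∷ us) v = end-∷ʳ u us v

end-∈ : {A : Set} (a : A) (us : List A) → end a us ∈ a ∷ us
end-∈ a []       = here refl
end-∈ a (u ∷ us) = there (end-∈ u us)

last≡end : {A : Set} (a : A) (us : List A) → last (a ∷ us) ≡ end a us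
last≡end a us with initLast us
... | []       = refl
... | us′ ∷ʳ′ v = ≡-sym (end-∷ʳ a us′ v)

AllPairs-∷ʳ⁻ : {A : Set} {R : A → A → Set} (xs : List A) {x : A}
             → AllPairs R (xs ∷ʳ x) → AllPairs R xs × All (λ y → R y x) xs
AllPairs-∷ʳ⁻ []       _         = [] , []
AllPairs-∷ʳ⁻ (y ∷ ys) (py ∷ ps) with AllPairs-∷ʳ⁻ ys ps | All-∷ʳ⁻ py
... | qs , all | py′ , Ryx = (py′ ∷ qs) , (Ryx ∷ all)

take-∷ʳ : {A : Set} (l : ℕ) (us : List A) (v : A) → take l (us ∷ʳ v) ≡ take l us ⊎ take l (us ∷ʳ v) ≡ us ∷ʳ v
take-∷ʳ zero    us       v = inj₁ refl
take-∷ʳ (suc l) []       v = inj₂ (cong (v ∷_) (take-[] l))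
take-∷ʳ (suc l) (u ∷ us) v with take-∷ʳ l us v
... | inj₁ eq = inj₁ (cong (u ∷_) eq)
... | inj₂ eq = inj₂ (cong (u ∷_) eq)

-- The length has to be adjustable: for `l` beyond the end of `us`, the same `l` would also take
-- `v`.
take-init : {A : Set} (l : ℕ) (us : List A) (v : A) → ∃[ l′ ] take l′ (us ∷ʳ v) ≡ take l us
take-init zero    us       v = 0 , refl
take-init (suc l) []       v = 0 , refl
take-init (suc l) (u ∷ us) v with take-init l us v
... | l′ , eq = suc l′ , cong (u ∷_) eq

module _ {n : ℕ} where

  edgesFrom-∷ʳ : (a : Fin n) (us : List (Fin n)) (v : Fin n)
               → edgesFrom a (us ∷ʳ v) ≡ edgesFrom a us ∷ʳ (end a us , v)
  edgesFrom-∷ʳ a []       v = refl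
  edgesFrom-∷ʳ a (u ∷ us) v = cong ((a , u) ∷_) (edgesFrom-∷ʳ u us v)

  lastStep-∷ʳ : (a : Fin n) (us : List (Fin n)) (v : Fin n) → lastStep a (us ∷ʳ v) ≡ just (end a us , v)
  lastStep-∷ʳ a []       v = refl
  lastStep-∷ʳ a (u ∷ us) v rewrite lastStep-∷ʳ u us v = refl

  IsWalk-∷ʳ⁺ : {G : Graph n} {a : Fin n} (us : List (Fin n)) {v : Fin n}
             → IsWalk G a us → adj G (end a us) v ≡ true → IsWalk G a (us ∷ʳ v)
  IsWalk-∷ʳ⁺ []       stop       a = step a stop
  IsWalk-∷ʳ⁺ (u ∷ us) (step b w) a = step b (IsWalk-∷ʳ⁺ us w a)

  IsWalk-∷ʳ⁻ : {G : Graph n} {a : Fin n} (us : List (Fin n)) {v : Fin n}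
             → IsWalk G a (us ∷ʳ v) → IsWalk G a us × adj G (end a us) v ≡ true
  IsWalk-∷ʳ⁻ []       (step a stop) = stop , a
  IsWalk-∷ʳ⁻ (u ∷ us) (step b w) with IsWalk-∷ʳ⁻ us w
  ... | w′ , a = step b w′ , a

  inWalk-∷ʳ : (a : Fin n) (us : List (Fin n)) (v u w : Fin n)
            → inWalk (a ∷ us ∷ʳ v) u w ≡ inWalk (a ∷ us) u w ∨ isEdge (end a us) v u w
  inWalk-∷ʳ a []        v u w = ∨-identityʳ _
  inWalk-∷ʳ a (u′ ∷ us) v u w = trans (cong (isEdge a u′ u w ∨_) (inWalk-∷ʳ u′ us v u w))
    (≡-sym (∨-assoc (isEdge a u′ u w) _ _))

  inWalk-sym : (a : Fin n) (us : List (Fin n)) (u w : Fin n) → inWalk (a ∷ us) u w ≡ inWalk (a ∷ us) w u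
  inWalk-sym a []        u w = refl
  inWalk-sym a (u′ ∷ us) u w = cong₂ _∨_ (isEdge-flip a u′ u w) (inWalk-sym u′ us u w)

  inWalk-false⁻ : (a : Fin n) (us : List (Fin n)) {x y : Fin n} → inWalk (a ∷ us) x y ≡ false
                → All (λ e → ¬ SameEdge e (x , y)) (edgesFrom a us)
  inWalk-false⁻ a []       eq = []
  inWalk-false⁻ a (u ∷ us) {x} {y} eq with isEdge a u x y in same
  ... | false = (λ s → not-¬ same (isEdge-complete a u x y s)) ∷ inWalk-false⁻ u us eq

  inWalk-false⁺ : (a : Fin n) (us : List (Fin n)) {x y : Fin n}
                → All (λ e → ¬ SameEdge e (x , y)) (edgesFrom a us) → inWalk (a ∷ us) x y ≡ false
  inWalk-false⁺ a []       []       = refl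
  inWalk-false⁺ a (u ∷ us) {x} {y} (p ∷ ps) rewrite isEdge-false a u x y p = inWalk-false⁺ u us ps

  -- Toggles compose by xor while `inWalk` collects edges by disjunction; the two agree because the
  -- new edge is not on the trail yet.
  △-∷ʳ : (S : Edges n) (a : Fin n) (us : List (Fin n)) (v : Fin n) → inWalk (a ∷ us) (end a us) v ≡ false
       → ∀ u w → toggle (S △ (a ∷ us)) (end a us) v u w ≡ (S △ (a ∷ us ∷ʳ v)) u w
  △-∷ʳ S a us v fresh u w = trans (xor-assoc (S u w) _ _)
    (cong (S u w xor_) (trans (xor≡∨ _ _ disjoint) (≡-sym (inWalk-∷ʳ a us v u w))))
    where
    xor≡∨ : ∀ p q → (q ≡ true → p ≡ false) → p xor q ≡ p ∨ q
    xor≡∨ false q     _ = refl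
    xor≡∨ true  false _ = refl
    xor≡∨ true  true  d with d refl
    ... | ()
    disjoint : isEdge (end a us) v u w ≡ true → inWalk (a ∷ us) u w ≡ false
    disjoint eq with isEdge-sound (end a us) v u w eq
    ... | inj₁ (refl , refl) = fresh
    ... | inj₂ (refl , refl) = trans (inWalk-sym a us v (end a us)) fresh

module Trails {n : ℕ} (G : Graph n) (H : Prescription n) (star : Star H) (F : Subgraph G)
              (F-low : ∀ x → ¬ (deg (edge F) x ∈H H x) → deg (edge F) x < mH H x) where

  open Optimal G H star

  E : Edges n
  E = edge F

  Fresh : Fin n → List (Fin n) → Fin n → Set
  Fresh a us v = inWalk (a ∷ us) (end a us) v ≡ false

  -- What conditions (a)-(c) demand of the old end of a trail once the edge to `v` is appended.
  record Exit (a : Fin n) (us : List (Fin n)) (v : Fin n) : Set where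
    field
      fromStart : us ≡ [] → E a v ≡ false
      atStart   : end a us ≡ a → defAt H (E △ (a ∷ us ∷ʳ v)) a < defAt H E a
      elsewhere : end a us ≢ a → defAt H E (end a us) ≡ 0 × defAt H (E △ (a ∷ us ∷ʳ v)) (end a us) ≡ 0
  open Exit

  deg-△-∷ʳ-other : ∀ a us v → Fresh a us v → ∀ {z} → z ≢ end a us → z ≢ v
                 → deg (E △ (a ∷ us ∷ʳ v)) z ≡ deg (E △ (a ∷ us)) z
  deg-△-∷ʳ-other a us v fresh {z} z≢e z≢v = trans
    (≡-sym (deg-cong {S = toggle (E △ (a ∷ us)) (end a us) v} {E △ (a ∷ us ∷ʳ v)} (△-∷ʳ E a us v fresh z)))
    (deg-toggle-other (E △ (a ∷ us)) z≢e z≢v)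

  deg-△-[] : ∀ a z → deg (E △ (a ∷ [])) z ≡ deg E z
  deg-△-[] a z = deg-cong {S = E △ (a ∷ [])} {E} λ y → xor-identityʳ _

  changeable-[] : ∀ {x} → InB0 H E x → Changeable G H E (x ∷ [])
  changeable-[] {x} x∈B₀ = (stop , []) , conds
    where
    conds : ∀ l → CondABC H E (x ∷ take l [])
    conds l rewrite take-[] {A = Fin n} l =
      x∈B₀ , (λ { y (here refl) y≢x _ → contradiction refl y≢x }) , λ ()

  changeable⇒conds : ∀ {a us} → Changeable G H E (a ∷ us) → CondABC H E (a ∷ us)
  changeable⇒conds {a} {us} (_ , conds) =
    subst (λ vs → CondABC H E (a ∷ vs)) (take-all (length us) us ≤-refl) (conds (length us))

  changeable⇒B₀ : ∀ {a us} → Changeable G H E (a ∷ us) → InB0 H E a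
  changeable⇒B₀ (_ , conds) = proj₁ (conds 0)

  -- The new edge changes degrees only at its two ends. The new end `v` is exempt from (b) and (c),
  -- and `Exit` covers the old one.
  changeable-∷ʳ⁺ : ∀ a us v → Changeable G H E (a ∷ us) → adj G (end a us) v ≡ true → Fresh a us v
                 → Exit a us v → Changeable G H E (a ∷ us ∷ʳ v)
  changeable-∷ʳ⁺ a us v ch@((walk′ , distinct) , conds) av fresh exit =
    (IsWalk-∷ʳ⁺ us walk′ av
    , subst (AllPairs _) (≡-sym (edgesFrom-∷ʳ a us v))
        (AllPairs.++⁺ distinct ([] ∷ []) (All.map (_∷ []) (inWalk-false⁻ a us fresh))))
    , conds′
    where
    condA : ∀ us → CondA H E (a ∷ us) → (us ≡ [] → E a v ≡ false) → CondA H E (a ∷ us ∷ʳ v)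
    condA []       a∈B₀ out = a∈B₀ , out refl
    condA (_ ∷ _)  cA   out = cA
    unchanged : ∀ {z} → z ≢ end a us → z ≢ v → defAt H (E △ (a ∷ us ∷ʳ v)) z ≡ defAt H (E △ (a ∷ us)) z
    unchanged {z} z≢e z≢v = cong (λ d → dist d (H z)) (deg-△-∷ʳ-other a us v fresh z≢e z≢v)
    lastEq : last (a ∷ us ∷ʳ v) ≡ v
    lastEq = trans (last≡end a (us ∷ʳ v)) (end-∷ʳ a us v)
    ∈-init : ∀ {z} xs → z ∈ xs ∷ʳ v → z ≢ v → z ∈ xs
    ∈-init xs z∈ z≢v with ∈-++⁻ xs z∈
    ... | inj₁ z∈xs       = z∈xs
    ... | inj₂ (here z≡v) = contradiction z≡v z≢v
    full : CondABC H E (a ∷ us ∷ʳ v)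
    full with changeable⇒conds ch
    ... | cA , cB , cC = condA us cA (fromStart exit) , condB , condC
      where
      condB : CondB H E (a ∷ us ∷ʳ v)
      condB z z∈ z≢a z≢last = cases (z ≟ end a us)
        where
        z≢v : z ≢ v
        z≢v z≡v = z≢last (trans z≡v (≡-sym lastEq))
        cases : Dec (z ≡ end a us) → defAt H E z ≡ 0 × defAt H (E △ (a ∷ us ∷ʳ v)) z ≡ 0
        cases (yes refl) = elsewhere exit z≢a
        cases (no z≢e) with cB z (∈-init (a ∷ us) z∈ z≢v) z≢a (λ eq → z≢e (trans eq (last≡end a us)))
        ... | d , d′ = d , trans (unchanged z≢e z≢v) d′
      condC : CondC H E (a ∷ us ∷ʳ v)
      condC a∈ a≢last = cases (a ≟ end a us)
        where
        a≢v : a ≢ v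
        a≢v a≡v = a≢last (trans a≡v (≡-sym lastEq))
        cases : Dec (a ≡ end a us) → defAt H (E △ (a ∷ us ∷ʳ v)) a < defAt H E a
        cases (yes a≡e) = atStart exit (≡-sym a≡e)
        cases (no a≢e)  = subst (_< defAt H E a) (≡-sym (unchanged a≢e a≢v))
          (cC (∈-init us a∈ a≢v) (λ eq → a≢e (trans eq (last≡end a us))))
    conds′ : ∀ l → CondABC H E (a ∷ take l (us ∷ʳ v))
    conds′ l with take-∷ʳ l us v
    ... | inj₁ eq = subst (λ vs → CondABC H E (a ∷ vs)) (≡-sym eq) (conds l)
    ... | inj₂ eq = subst (λ vs → CondABC H E (a ∷ vs)) (≡-sym eq) full

  record Unsnoc (a : Fin n) (us : List (Fin n)) (v : Fin n) : Set where
    field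
      initial  : Changeable G H E (a ∷ us)
      adjacent : adj G (end a us) v ≡ true
      fresh    : Fresh a us v
      exit     : Exit a us v
  open Unsnoc

  changeable-∷ʳ⁻ : ∀ a us v → Changeable G H E (a ∷ us ∷ʳ v) → Unsnoc a us v
  changeable-∷ʳ⁻ a us v ch@((walk′ , distinct) , conds) = record
    { initial = (proj₁ walks , proj₁ pairs) , conds′
    ; adjacent = proj₂ walks
    ; fresh = fresh′
    ; exit = record { fromStart = out us cA ; atStart = atStart′ us refl ; elsewhere = elsewhere′ }
    }
    where
    walks = IsWalk-∷ʳ⁻ us walk′
    pairs = AllPairs-∷ʳ⁻ (edgesFrom a us) (subst (AllPairs _) (edgesFrom-∷ʳ a us v) distinct)
    fresh′ = inWalk-false⁺ a us (proj₂ pairs)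
    cA = proj₁ (changeable⇒conds ch)
    cB = proj₁ (proj₂ (changeable⇒conds ch))
    cC = proj₂ (proj₂ (changeable⇒conds ch))
    lastEq : last (a ∷ us ∷ʳ v) ≡ v
    lastEq = trans (last≡end a (us ∷ʳ v)) (end-∷ʳ a us v)
    e≢last : ∀ {z} → z ≡ end a us → z ≢ last (a ∷ us ∷ʳ v)
    e≢last z≡e eq = adj⇒≢ (proj₂ walks) (trans (≡-sym z≡e) (trans eq lastEq))
    conds′ : ∀ l → CondABC H E (a ∷ take l us)
    conds′ l with take-init l us v
    ... | l′ , eq = subst (λ vs → CondABC H E (a ∷ vs)) eq (conds l′)
    out : ∀ us → CondA H E (a ∷ us ∷ʳ v) → us ≡ [] → E a v ≡ false
    out .[] cA refl = proj₂ cA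
    atStart′ : ∀ us′ → us′ ≡ us → end a us ≡ a → defAt H (E △ (a ∷ us ∷ʳ v)) a < defAt H E a
    -- For a single edge (c) is vacuous. The gain comes from the degree of `a` lying below `mH H a`
    -- and the edge being outside `F`.
    atStart′ [] refl _ = Good⇒closer false (star a)
      (trans (≡-sym (deg-cong {S = toggle (E △ (a ∷ [])) a v} {E △ (a ∷ v ∷ [])} (△-∷ʳ E a [] v fresh′ a)))
        (trans (deg-toggle-tail (E △ (a ∷ [])) (adj⇒≢ (proj₂ walks))
                 (trans (xor-identityʳ (E a v)) (proj₂ cA)))
          (cong suc (deg-△-[] a a))))
      a∈B₀ (<-≤-trans (F-low a a∈B₀) (minimum-≤ (H a) (maximum-∈ (H a))))
      where a∈B₀ = changeable⇒B₀ {us = us ∷ʳ v} ch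
    atStart′ (u ∷ us′) refl e≡a = cC (∈-++⁺ˡ (subst (_∈ u ∷ us′) e≡a (end-∈ u us′))) (e≢last (≡-sym e≡a))
    elsewhere′ : end a us ≢ a → defAt H E (end a us) ≡ 0 × defAt H (E △ (a ∷ us ∷ʳ v)) (end a us) ≡ 0
    elsewhere′ e≢a = cB (end a us) (∈-++⁺ˡ (end-∈ a us)) e≢a (e≢last refl)

  -- The degrees d that a changeable trail starting in a may leave behind at y.
  Rest : Fin n → Fin n → ℕ → Set
  Rest a y d = (y ≡ a × dist d (H y) < defAt H E y)
             ⊎ (y ≢ a × (d ≡ deg E y ⊎ (defAt H E y ≡ 0 × dist d (H y) ≡ 0)))

  -- The degree at `y` is frozen once the trail leaves `y` for the last time, and `Exit` describes
  -- exactly that moment.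
  changeable⇒rest : ∀ {a us} → Reverse us → Changeable G H E (a ∷ us) → ∀ {y} → y ≢ end a us
                  → Rest a y (deg (E △ (a ∷ us)) y)
  changeable⇒rest {a} [] ch {y} y≢a = inj₂ (y≢a , inj₁ (deg-△-[] a y))
  changeable⇒rest {a} (us ∶ r ∶ʳ v) ch {y} y≢last = cases (y ≟ end a us) (y ≟ a)
    where
    un = changeable-∷ʳ⁻ a us v ch
    y≢v : y ≢ v
    y≢v y≡v = y≢last (trans y≡v (≡-sym (end-∷ʳ a us v)))
    cases : Dec (y ≡ end a us) → Dec (y ≡ a) → Rest a y (deg (E △ (a ∷ us ∷ʳ v)) y)
    cases (yes refl) (yes e≡a) = inj₁ (e≡a , subst (λ z → defAt H (E △ (a ∷ us ∷ʳ v)) z < defAt H E z)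
                                               (≡-sym e≡a) (atStart (exit un) e≡a))
    cases (yes refl) (no e≢a)  = inj₂ (e≢a , inj₂ (elsewhere (exit un) e≢a))
    cases (no y≢e)   _         = subst (Rest a y) (≡-sym (deg-△-∷ʳ-other a us v (fresh un) y≢e y≢v))
                                   (changeable⇒rest r (initial un) y≢e)

  -- The degree at the end of a changeable trail before its last edge was toggled.
  changeable⇒previous : ∀ {a us} → Reverse us → Changeable G H E (a ∷ us)
                      → us ≡ [] ⊎ ∃[ d ] ∃[ b ] (Rest a (end a us) d × Shift b d (deg (E △ (a ∷ us)) (end a us)))
  changeable⇒previous [] ch = inj₁ refl
  changeable⇒previous {a} (us ∶ r ∶ʳ v) ch rewrite end-∷ʳ a us v = inj₂
    ( deg (E △ (a ∷ us)) v , (E △ (a ∷ us)) v (end a us)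
    , changeable⇒rest r (initial un) (adj⇒≢ (adjacent un) ∘ ≡-sym)
    , subst (Shift _ _) (deg-cong {S = toggle (E △ (a ∷ us)) (end a us) v} {E △ (a ∷ us ∷ʳ v)} (△-∷ʳ E a us v (fresh un) v))
        (deg-toggle-head (E △ (a ∷ us)) (adj⇒≢ (adjacent un)) refl))
    where un = changeable-∷ʳ⁻ a us v ch

  changeable⇒subgraph : ∀ {a us} → Reverse us → Changeable G H E (a ∷ us)
                      → ∃[ X ] (∀ u w → edge X u w ≡ (E △ (a ∷ us)) u w)
  changeable⇒subgraph [] ch = F , λ u w → ≡-sym (xor-identityʳ _)
  changeable⇒subgraph {a} (us ∶ r ∶ʳ v) ch with changeable-∷ʳ⁻ a us v ch
  ... | un with changeable⇒subgraph r (initial un)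
  ...   | X , X≗ = toggled X (end a us) v (adjacent un)
                 , λ u w → trans (cong (_xor isEdge (end a us) v u w) (X≗ u w)) (△-∷ʳ E a us v (fresh un) u w)

  -- Changeable trails and optimality: defects at their ends, and traces of `F` as changeable trails

  module _ (F-optimal : HOptimal H F) where

    -- Unless `F` itself misses the end, take F △ P: it gains at the start, loses at most one at the
    -- end and is no worse elsewhere. If it hit `H` at the end, it would beat `F`.
    changeable⇒missed : ∀ a us → Changeable G H E (a ∷ us) → ∃[ X ] (HOptimal H X × Missed X (end a us))
    changeable⇒missed a us ch with deg E (end a us) ∈? toList (H (end a us))
    ... | no  Fv∉ = F , F-optimal , Fv∉
    ... | yes Fv∈ with changeable⇒subgraph (reverseView us) ch
    ...   | X , X≗ = X , (λ Z → ≤-trans X≤F (F-optimal Z)) , missedX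
      where
      v = end a us
      X≡ : ∀ z → deg (E △ (a ∷ us)) z ≡ degree X z
      X≡ z = ≡-sym (deg-cong {S = edge X} {E △ (a ∷ us)} (X≗ z))
      rest : ∀ z → z ≢ v → Rest a z (degree X z)
      rest z z≢v = subst (Rest a z) (X≡ z) (changeable⇒rest (reverseView us) ch z≢v)
      a≢v : a ≢ v
      a≢v eq = changeable⇒B₀ {us = us} ch (subst (λ z → deg E z ∈H H z) (≡-sym eq) Fv∈)
      le : ∀ z → z ≢ v → defAt H (edge X) z ≤ defAt H E z
      le z z≢v with rest z z≢v
      ... | inj₁ (_ , lt) = <⇒≤ lt
      ... | inj₂ (_ , inj₁ eq) = ≤-reflexive (cong (λ d → dist d (H z)) eq)
      ... | inj₂ (_ , inj₂ (_ , zero′)) = ≤-trans (≤-reflexive zero′) z≤n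
      lt : defAt H (edge X) a < defAt H E a
      lt with rest a a≢v
      ... | inj₁ (_ , lt′) = lt′
      ... | inj₂ (a≢a , _) = contradiction refl a≢a
      atEnd : defAt H (edge X) v ≤ suc (defAt H E v)
      atEnd with changeable⇒previous (reverseView us) ch
      ... | inj₁ refl = contradiction refl a≢v
      ... | inj₂ (d , b , inj₁ (v≡a , _) , _) = contradiction (≡-sym v≡a) a≢v
      ... | inj₂ (d , b , inj₂ (_ , r) , shift) = ≤-trans
        (dist-Lipschitz d (degree X v) (H v) (Shift⇒close b (subst (Shift b d) (X≡ v) shift)))
        (s≤s (prev r))
        where
        prev : d ≡ deg E v ⊎ (defAt H E v ≡ 0 × dist d (H v) ≡ 0) → dist d (H v) ≤ defAt H E v
        prev (inj₁ refl) = ≤-refl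
        prev (inj₂ (_ , zero′)) = ≤-trans (≤-reflexive zero′) z≤n
      X≤F : defSum H (edge X) ≤ defSum H E
      X≤F = total-transfer _ _ a v a≢v lt atEnd (λ z _ z≢v → le z z≢v)
      missedX : Missed X v
      missedX Xv∈ = <⇒≱ (total-mono-< _ _ le′ a lt) (F-optimal X)
        where
        le′ : ∀ z → defAt H (edge X) z ≤ defAt H E z
        le′ z with z ≟ v
        ... | no z≢v = le z z≢v
        ... | yes refl = ≤-trans (≤-reflexive (∈⇒dist≡0 _ (H v) Xv∈)) z≤n

    record Reached (W : Subgraph G) (x : Fin n) : Set where
      field
        start      : Fin n
        tail       : List (Fin n)
        changeable : Changeable G H E (start ∷ tail)
        ends       : end start tail ≡ x
        realises   : ∀ u w → edge W u w ≡ (E △ (start ∷ tail)) u w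

    -- Keeps the last edge in view, since the parity of the trail depends on it.
    record Extended (W : Subgraph G) (y x : Fin n) (a : adj G y x ≡ true) : Set where
      field
        start      : Fin n
        init       : List (Fin n)
        changeable : Changeable G H E (start ∷ init ∷ʳ x)
        penult     : end start init ≡ y
        realises   : ∀ u w → edge (toggled W y x a) u w ≡ (E △ (start ∷ init ∷ʳ x)) u w

    mutual
      -- The second component remembers that the trace could not have started at its current end;
      -- `extend` needs this to show that `F` does not miss inner vertices.
      reach : ∀ {b x W} → Trace F b x W → ∃[ r ] (x ≢ Reached.start {W} {x} r → ¬ CanStop F b x)
      reach {x = x} (stop (missedF , _)) = record
        { start = x ; tail = [] ; changeable = changeable-[] missedF ; ends = refl
        ; realises = λ u w → ≡-sym (xor-identityʳ _) } , λ x≢x → contradiction refl x≢x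
      reach {x = x} (step t a Wyx Fyx _ ¬stop) with extend t a Wyx Fyx
      ... | record { start = start ; init = init ; changeable = changeable ; realises = realises } = record
        { start = start ; tail = init ∷ʳ x ; changeable = changeable ; ends = end-∷ʳ start init x
        ; realises = realises } , λ _ → ¬stop

      -- Equal status in `W` and `F` makes the edge `y x` fresh. The defect of `W` at `y` exceeds
      -- the one before the last arrival by at most one, and toggling `y x` strictly lowers it,
      -- which gives (b) and (c) at `y`.
      extend : ∀ {b y W} → Trace F b y W → ∀ {x} (a : adj G y x ≡ true)
             → edge W y x ≡ b → E y x ≡ b → Extended W y x a
      extend {b} {W = W} t {x} a Wyx Fyx with trace⇒defective F F-optimal t | reach t
      ... | d | record { start = s ; tail = us ; changeable = ch ; ends = refl ; realises = W≗ } , ¬stop = record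
        { start = s ; init = us ; penult = refl ; realises = W′≗
        ; changeable = changeable-∷ʳ⁺ s us x ch a fresh′ (record
            { fromStart = λ us≡[] → trans (subst (λ vs → E (end s vs) x ≡ b) us≡[] Fyx) (status us≡[]) ; atStart = atStart′ ; elsewhere = elsewhere′ })
        }
        where
        y = end s us
        xor-cancel : ∀ b c → b ≡ b xor c → c ≡ false
        xor-cancel false false _ = refl
        xor-cancel true  false _ = refl
        fresh′ : Fresh s us x
        fresh′ = xor-cancel b _ (trans (≡-sym Wyx) (trans (W≗ y x) (cong (_xor inWalk (s ∷ us) y x) Fyx)))
        W′≗ : ∀ u w → edge (toggled W y x a) u w ≡ (E △ (s ∷ us ∷ʳ x)) u w
        W′≗ u w = trans (cong (_xor isEdge y x u w) (W≗ u w)) (△-∷ʳ E s us x fresh′ u w)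
        W≡ : deg (E △ (s ∷ us)) y ≡ degree W y
        W≡ = ≡-sym (deg-cong {S = edge W} {E △ (s ∷ us)} (W≗ y))
        W′≡ : deg (E △ (s ∷ us ∷ʳ x)) y ≡ degree (toggled W y x a) y
        W′≡ = ≡-sym (deg-cong {S = edge (toggled W y x a)} {E △ (s ∷ us ∷ʳ x)} (W′≗ y))
        closer : dist (deg (E △ (s ∷ us ∷ʳ x)) y) (H y) < dist (degree W y) (H y)
        closer rewrite W′≡ = Good⇒closer b (star y) (deg-toggle-tail (edge W) (adj⇒≢ a) Wyx) (Defective.missed d) (Defective.good d)
        near : ∀ {p c} → Shift c p (deg (E △ (s ∷ us)) y) → dist (degree W y) (H y) ≤ suc (dist p (H y))
        near {p} {c} shift = dist-Lipschitz p (degree W y) (H y) (Shift⇒close c (subst (Shift c p) W≡ shift))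
        restored : ∀ {p c} → Shift c p (deg (E △ (s ∷ us)) y) → dist p (H y) ≡ 0 → defAt H (E △ (s ∷ us ∷ʳ x)) y ≡ 0
        restored {p} {c} shift p0 = n≤0⇒n≡0 (≤-trans (s≤s⁻¹ (≤-trans closer (near {p} {c} shift))) (≤-reflexive p0))
        -- A defect of `F` lies below `mH`, so only adding an edge can be `Good` at the start.
        status : us ≡ [] → b ≡ false
        status refl = go b (Defective.good d)
          where
          go : ∀ b → Good (H s) b (degree W s) → b ≡ false
          go false _   = refl
          go true  m<W = contradiction
            (subst (mH H s <_) (trans (≡-sym W≡) (deg-△-[] s s)) m<W)
            (<⇒≯ (F-low s (changeable⇒B₀ {us = []} ch)))
        atStart′ : y ≡ s → defAt H (E △ (s ∷ us ∷ʳ x)) s < defAt H E s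
        atStart′ y≡s = subst (λ z → defAt H (E △ (s ∷ us ∷ʳ x)) z < defAt H E z) y≡s bound
          where
          bound : defAt H (E △ (s ∷ us ∷ʳ x)) y < defAt H E y
          bound with changeable⇒previous (reverseView us) ch
          ... | inj₁ refl = subst (λ e → defAt H (E △ (s ∷ x ∷ [])) s < dist e (H s)) (trans (≡-sym W≡) (deg-△-[] s s)) closer
          ... | inj₂ (p , c , inj₁ (_ , lt) , shift) = <-≤-trans closer (≤-trans (near {p} {c} shift) lt)
          ... | inj₂ (_ , _ , inj₂ (y≢s , _) , _) = contradiction y≡s y≢s
        elsewhere′ : y ≢ s → defAt H E y ≡ 0 × defAt H (E △ (s ∷ us ∷ʳ x)) y ≡ 0
        elsewhere′ y≢s with changeable⇒previous (reverseView us) ch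
        ... | inj₁ refl = contradiction refl y≢s
        ... | inj₂ (_ , _ , inj₁ (y≡s , _) , _) = contradiction y≡s y≢s
        ... | inj₂ (p , c , inj₂ (_ , inj₂ (F0 , p0)) , shift) = F0 , restored {p} {c} shift p0
        ... | inj₂ (p , c , inj₂ (_ , inj₁ refl) , shift) with deg E y ∈? toList (H y)
        ...   | yes F∈ = ∈⇒dist≡0 _ (H y) F∈ , restored {p} {c} shift (∈⇒dist≡0 _ (H y) F∈)
        -- One step above the degree in `F` still is at most `mH`, so removing an edge is not
        -- `Good`; if adding one is, the trace could have started at `y`.
        ...   | no  F∉ = ⊥-elim (impossible b (Defective.good d) (¬stop y≢s))
          where
          ≤1+ : ∀ c {p q} → Shift c p q → q ≤ suc p
          ≤1+ false refl = ≤-refl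
          ≤1+ true  refl = m≤n⇒m≤1+n (n≤1+n _)
          impossible : ∀ b → Good (H y) b (degree W y) → ¬ ¬ CanStop F b y
          impossible true m<W _ = <⇒≱ m<W (≤-trans (≤-reflexive (≡-sym W≡)) (≤-trans (≤1+ c shift) (F-low y F∉)))
          impossible false _ ¬stop = ¬stop (F∉ , <-≤-trans (F-low y F∉) (minimum-≤ (H y) (maximum-∈ (H y))))

-- The chosen subgraph `F`

deg-empty : {n : ℕ} (x : Fin n) → deg (λ _ _ → false) x ≡ 0
deg-empty {n} x = total-0 n
  where
  total-0 : ∀ n → total {n} (λ _ → 0) ≡ 0
  total-0 zero    = refl
  total-0 (suc n) = trans (total-suc {n} (λ _ → 0)) (total-0 n)

module Chosen {n : ℕ} (G : Graph n) (H : Prescription n) (star : Star H) (F : Subgraph G) (chosen : ChosenF H F) where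

  open Optimal G H star

  empty : Subgraph G
  empty = record { edge = λ _ _ → false ; sym = λ _ _ → refl ; sub = λ _ _ () }

  exceeding-edge : ∀ X Y x → degree Y x < degree X x → ∃[ y ] (edge X x y ≡ true × edge Y x y ≡ false)
  exceeding-edge X Y x Y<X with exit? X Y x true
  ... | inj₁ found = found
  ... | inj₂ keep  = contradiction (deg-mono {S = edge X} {edge Y} keep) (<⇒≱ Y<X)

  neighbour : ∀ X x → 0 < degree X x → ∃[ y ] edge X x y ≡ true
  neighbour X x 0<X with exceeding-edge X empty x (subst (_< degree X x) (≡-sym (deg-empty x)) 0<X)
  ... | y , Xxy , _ = y , Xxy

  F-bounded : Bounded H F
  F-bounded = proj₁ chosen

  -- Removing an edge at a vertex of too large degree does not increase the deficiency.
  F-optimal : HOptimal H F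
  F-optimal Z = go Z (<-wellFounded _)
    where
    -- The distance to the empty subgraph is twice the number of edges of `Z`, so it drops with each
    -- removal.
    go : ∀ Z → Acc _<_ (distance Z empty) → defSum H (edge F) ≤ defSum H (edge Z)
    go Z (acc rec) with any? (λ z → MH H z <? degree Z z)
    ... | no  none = proj₁ (proj₂ chosen) Z λ z → ≮⇒≥ λ M<Z → none (z , M<Z)
    ... | yes (z , M<Z) with neighbour Z z (≤-<-trans z≤n M<Z)
    ...   | y , Zzy = ≤-trans (go (toggled Z z y a) (rec (distance-toggled Z empty a true Zzy refl)))
              (defSum-toggled-≤ Z a Zzy (λ Z∈ → <⇒≱ M<Z (≤-maximum (H z) Z∈))
                (≤-<-trans (minimum-≤ (H z) (maximum-∈ (H z))) M<Z))
      where a = sub Z z y Zzy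

  -- Otherwise removing an edge at x would contradict the minimality of E(F).
  F-low : ∀ x → Missed F x → degree F x < mH H x
  F-low x missed with degree F x <? mH H x
  ... | yes F<m = F<m
  ... | no  F≮m = ⊥-elim (absurd (≤∧≢⇒< (≮⇒≥ F≮m) λ eq → missed (subst (_∈H H x) eq (minimum-∈ (H x)))))
    where
    unchanged : mH H x < degree F x → ∀ y → edge F x y ≡ true → toggle (edge F) x y x y ≡ edge F x y
    unchanged m<F y Fxy = proj₂ (proj₂ chosen) F′ bounded
      (≤-antisym (defSum-toggled-≤ F a Fxy missed m<F) (F-optimal F′)) F′⊆F x y
      where
      a = sub F x y Fxy
      F′ = toggled F x y a
      F′⊆F : ∀ u w → edge F′ u w ≡ true → edge F u w ≡ true
      F′⊆F u w eq with isEdge x y u w in same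
      ... | false = trans (≡-sym (xor-identityʳ _)) eq
      ... | true with isEdge-sound x y u w same
      ...   | inj₁ (refl , refl) = Fxy
      ...   | inj₂ (refl , refl) = trans (Subgraph.sym F y x) Fxy
      bounded : Bounded H F′
      bounded z = ≤-trans (deg-mono {S = edge F′} {edge F} (F′⊆F z)) (F-bounded z)
    absurd : ¬ (mH H x < degree F x)
    absurd m<F with neighbour F x (≤-<-trans z≤n m<F)
    ... | y , Fxy = not-b≢b (edge F x y)
      (trans (≡-sym (toggle-on (edge F) x y x y (inj₁ (refl , refl)))) (unchanged m<F y Fxy))

  open Trails G H star F F-low

  evenTo-missed : ∀ {v} → Missed F v → EvenTo G H E v
  evenTo-missed {v} missed = (v ∷ []) , changeable-[] missed , inj₁ refl , refl

  -- Toggling `v y` in `U` before tracing forces the resulting trail to end with this edge, whose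
  -- status in `F` fixes the parity.
  trailTo : ∀ U {v y} b → edge U v y ≡ b → E v y ≡ not b → Defective U v b
          → ∃[ s ] ∃[ us ] (Changeable G H E (s ∷ us ∷ʳ v) × lastStep s (us ∷ʳ v) ≡ just (y , v)
                            × E y v ≡ not b × last (s ∷ us ∷ʳ v) ≡ v)
  trailTo U {v} {y} b Uvy Fvy def with trace F F-optimal (toggled U v y a) (push U a Uvy def)
    where a = differ⇒adj U F b Uvy Fvy
  ... | W , t , btw with between-at F F-optimal U W (differ⇒adj U F b Uvy Fvy) b Uvy Fvy btw
  ...   | Wyv , Fyv with extend F-optimal t (adj-sym (differ⇒adj U F b Uvy Fvy)) Wyv Fyv
  ...     | record { start = s ; init = us ; changeable = ch ; penult = refl } =
            s , us , ch , lastStep-∷ʳ s us v , Fyv , trans (last≡end s (us ∷ʳ v)) (end-∷ʳ s us v)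

  -- Some edge of `F` at `v` is absent from `U`, and adding it to `U` is `Good` because `F` is
  -- bounded by `MH`.
  evenTo : ∀ U {v} → HOptimal H U → Missed U v → degree U v < degree F v → EvenTo G H E v
  evenTo U {v} opt missed U<F with exceeding-edge F U v U<F
  ... | y , Fvy , Uvy with trailTo U false Uvy Fvy
                             (record { optimal = opt ; missed = missed ; good = <-≤-trans U<F (F-bounded v) })
  ...   | s , us , ch , step′ , Fyv , last′ = (s ∷ us ∷ʳ v) , ch , inj₂ (y , v , step′ , Fyv) , last′

  -- Here the bound by `mH` has to be assumed, since `F` may lie below it.
  oddTo : ∀ U {v} → HOptimal H U → Missed U v → degree F v < degree U v → mH H v < degree U v → OddTo G H E v
  oddTo U {v} opt missed F<U m<U with exceeding-edge U F v F<U
  ... | y , Uvy , Fvy with trailTo U true Uvy Fvy (record { optimal = opt ; missed = missed ; good = m<U })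
  ...   | s , us , ch , step′ , Fyv , last′ = (s ∷ us ∷ʳ v) , ch , (y , v , step′ , Fyv) , last′

  -- Degrees of an arbitrary optimal subgraph `R`

  module _ (R : Subgraph G) (R-optimal : HOptimal H R) where

    -- An optimal subgraph missing the end of `P` is traced back to a defect of `R`.
    changeable⇒nearMiss : ∀ {P} → Changeable G H E P → degree R (last P) ∈H H (last P) → NearMiss R R-optimal (last P)
    changeable⇒nearMiss {s ∷ us} ch R∈ rewrite last≡end s us with changeable⇒missed F-optimal s us ch
    ... | X , optX , missX = nearMiss R R-optimal X optX missX R∈

    C-exact : ∀ v → InC G H E v → degree R v ∈H H v
    C-exact v (¬A , ¬B , ¬D) with degree R v ∈? toList (H v)
    ... | yes R∈ = R∈
    ... | no  R∉ = contradiction trailTo-v λ { (inj₁ even) → ¬B (even , ¬D) ; (inj₂ odd) → ¬A (odd , ¬D) }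
      where
      trailTo-v : EvenTo G H E v ⊎ OddTo G H E v
      trailTo-v with degree F v ∈? toList (H v)
      ... | no  F∉ = inj₁ (evenTo-missed F∉)
      ... | yes F∈ with <-cmp (degree R v) (degree F v)
      ...   | tri< R<F _ _ = inj₁ (evenTo R R-optimal R∉ R<F)
      ...   | tri≈ _ R≡F _ = contradiction (subst (_∈H H v) (≡-sym R≡F) F∈) R∉
      ...   | tri> _ _ F<R = inj₂ (oddTo R R-optimal R∉ F<R (≤-<-trans (minimum-≤ (H v) F∈) F<R))

    A-high : ∀ v → InA G H E v → MH H v ≤ degree R v
    A-high v (odd@(P , ch , _ , refl) , ¬D) = ≮⇒≥ λ R<M → ¬D (inj₁ (even R<M , odd))
      where
      even : degree R v < MH H v → EvenTo G H E v
      even R<M with degree F v ∈? toList (H v)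
      ... | no  F∉ = evenTo-missed F∉
      ... | yes F∈ with degree F v <? MH H v
      -- Alternative (iii) in the definition of D.
      ...   | yes F<M = contradiction (inj₂ (inj₂ ((minimum-≤ (H v) F∈ , F<M) , odd))) ¬D
      ...   | no  F≮M with degree R v ∈? toList (H v)
      ...     | no  R∉ = evenTo R R-optimal R∉ (<-≤-trans R<M (≮⇒≥ F≮M))
      ...     | yes R∈ with changeable⇒nearMiss ch R∈
      -- One step from a degree below `MH H v` leads at most to `MH H v`, which is prescribed and
      -- hence not the missed degree of `U`.
      ...       | U , b , optU , missU , shift = evenTo U optU missU
                    (<-≤-trans (≤∧≢⇒< (U≤M b shift) λ eq → missU (subst (_∈H H v) (≡-sym eq) (maximum-∈ (H v)))) (≮⇒≥ F≮M))
        where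
        U≤M : ∀ b → Shift b (degree R v) (degree U v) → degree U v ≤ MH H v
        U≤M false eq = subst (_≤ MH H v) (≡-sym eq) R<M
        U≤M true  eq = ≤-trans (n≤1+n _) (subst (_≤ MH H v) eq (<⇒≤ R<M))

    -- Mirror image of `A-high`, with (ii) in place of (iii). Vertices missed by `F` need no case of
    -- their own, as `oddTo` only compares degrees.
    B-low : ∀ v → InB G H E v → degree R v ≤ mH H v
    B-low v (even@(P , ch , _ , refl) , ¬D) = ≮⇒≥ λ m<R → ¬D (inj₁ (even , odd m<R))
      where
      odd : mH H v < degree R v → OddTo G H E v
      odd m<R with mH H v <? degree F v
      ... | yes m<F = contradiction (inj₂ (inj₁ ((m<F , F-bounded v) , even))) ¬D
      ... | no  m≮F with degree R v ∈? toList (H v)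
      ...   | no  R∉ = oddTo R R-optimal R∉ (≤-<-trans (≮⇒≥ m≮F) m<R) m<R
      ...   | yes R∈ with changeable⇒nearMiss ch R∈
      ...     | U , b , optU , missU , shift = oddTo U optU missU (≤-<-trans (≮⇒≥ m≮F) m<U) m<U
        where
        m≤U : ∀ b → Shift b (degree R v) (degree U v) → mH H v ≤ degree U v
        m≤U false eq = subst (mH H v ≤_) (≡-sym eq) (≤-trans (<⇒≤ m<R) (n≤1+n _))
        m≤U true  eq = s≤s⁻¹ (subst (mH H v <_) eq m<R)
        m<U : mH H v < degree U v
        m<U = ≤∧≢⇒< (m≤U b shift) λ eq → missU (subst (_∈H H v) eq (minimum-∈ (H v)))

theorem4 : (n : ℕ) (G : Graph n) (H : Prescription n)
    → Star H
    → ¬ HasHFactor G H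
    → (F : Subgraph G) → ChosenF H F
    → (R : Subgraph G) → HOptimal H R
    → (∀ v → InC G H (edge F) v → deg (edge R) v ∈H H v)
    × (∀ v → InA G H (edge F) v → MH H v ≤ deg (edge R) v)
    × (∀ v → InB G H (edge F) v → deg (edge R) v ≤ mH H v)
theorem4 n G H star _ F chosen R R-optimal = C-exact R R-optimal , A-high R R-optimal , B-low R R-optimal
  where open Chosen G H star F chosen
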